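{- For every positive integer $n$, $$\sum_{\substack{k,\ell\ge 0\\ k+\ell<n}} u^k v^\ell \sum_{w\in \mathrm{SW}(1^n,k,\ell)} q^{\mathrm{sminv}(w)} \;=\; \sum_{\pi\in\Pi(n)_{>0}} u^{\deg_\theta(\pi)}\, v^{\deg_\xi(\pi)}\, \mathrm{stair}_q(\pi).$$
   Context: **Left side.** A segmented permutation of length $n$ is a permutation $\sigma_1\cdots\sigma_n$ of $\{1,\ldots,n\}$ cut into consecutive nonempty blocks. An ascent (resp. descent) is an index $i$ such that $\sigma_i,\sigma_{i+1}$ lie in the same block and $\sigma_i<\sigma_{i+1}$ (resp. $\sigma_i>\sigma_{i+1}$). $\mathrm{SW}(1^n,k,\ell)$ is the set of segmented permutations of length $n$ with exactly $k$ ascents and exactly $\ell$ descents. A sminversion of $\sigma$ is a pair $(i,j)$ with $1\le i<j\le n$, $\sigma_i>\sigma_j$, and either $\sigma_j$ is the first letter of its block or $\sigma_{j-1}>\sigma_i$. $\mathrm{sminv}(\sigma)$ is the number of sminversions. **Right side.** $\Pi(n)_{>0}$ is the set of modified Motzkin paths of length $n$: lattice paths $\pi=(p_1,\ldots,p_n)$ in $\mathbb{Z}^2$ starting at $(0,0)$ whose $i$-th step $p_i$ is one of: an (undecorated) up-step $(1,1)$; a horizontal step $(1,0)$ with decoration $\theta_i$; a horizontal step $(1,0)$ with decoration $\xi_i$; a down-step $(1,-1)$ with decoration $\theta_i\xi_i$; such that the first step is an up-step and afterwards the path never goes below the line $y=1$. Let $T(\pi)$ (resp. $S(\pi)$) be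 the set of indices $i$ such that $\theta_i$ (resp. $\xi_i$) occurs in the decoration of $p_i$, and $\deg_\theta(\pi)=|T(\pi)|$, $\deg_\xi(\pi)=|S(\pi)|$. For $T,S\subseteq\{2,\ldots,n\}$ define $\alpha(T,S)$ by $\alpha_1(T,S)=0$ and, for $2\le i\le n$, $\alpha_i(T,S)=\alpha_{i-1}(T,S)-1+\chi(i\notin T)+\chi(i\notin S)$, where $\chi(P)=1$ if $P$ is true and $0$ otherwise. With $[m]_q=1+q+\cdots+q^{m-1}$, put $\mathrm{stair}_q(\pi)=\prod_{i=1}^n[\alpha_i(T(\pi),S(\pi))+1]_q$. -}

module Defs where

open import Algebra.Bundles using (CommutativeSemiring)
open import Data.Bool.Base using (Bool; true; false; not; if_then_else_)
open import Data.Fin.Base using (Fin; toℕ; _<_)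
open import Data.Fin.Properties as Fin using (_<?_)
open import Data.Fin.Subset using (Subset; Side; inside; outside; _∈_; _∉_; ∣_∣)
open import Data.Fin.Subset.Properties using (_∈?_)
open import Data.Integer.Base as ℤ using (ℤ; 0ℤ; 1ℤ; -1ℤ)
import Data.Integer.Properties as ℤ
open import Data.List.Base
  using (List; []; _∷_; [_]; length; filter; foldr; allFin; upTo;
         cartesianProduct; cartesianProductWith)
open import Data.Nat.Base as ℕ using (ℕ; zero; suc)
import Data.Nat.Properties as ℕ
open import Data.Product.Base using (_×_; _,_; proj₁; proj₂; ∃)
open import Data.Sum.Base using (_⊎_)
open import Data.Vec.Base as Vec using (Vec; []; _∷_; lookup)
open import Data.Vec.Relation.Unary.All as All using (All)
open import Data.Vec.Relation.Unary.AllPairs as AllPairs using ()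
open import Data.Vec.Relation.Unary.Unique.Propositional using (Unique)
open import Relation.Binary.PropositionalEquality.Core using (_≡_; refl)
open import Relation.Nullary.Decidable
  using (Dec; yes; no; ¬?; _×-dec_; _⊎-dec_; _→-dec_)
open import Relation.Unary using (Decidable)

private variable
  n : ℕ

-- Every vector of length n over the alphabet xs; each occurs exactly once
-- when xs has no repetitions.
words : {A : Set} → List A → (n : ℕ) → List (Vec A n)
words xs zero    = [ [] ]
words xs (suc n) = cartesianProductWith _∷_ xs (words xs n)

count : {A : Set} {P : A → Set} → Decidable P → List A → ℕ
count P? xs = length (filter P? xs)

-- Positions and letters 1, …, n are both represented by Fin n (shifted to
-- 0, …, n-1).  The cutting into consecutive nonempty blocks is recorded by
-- the set of positions at which a block starts.
record SegmentedWord (n : ℕ) : Set where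
  constructor segmented
  field
    letters : Vec (Fin n) n
    starts  : Subset n

  σ : Fin n → Fin n
  σ = lookup letters

open SegmentedWord public

-- n pairwise distinct letters from an n-letter alphabet form a permutation;
-- the first position (if any) always starts a block.
IsSegmentedPermutation : SegmentedWord n → Set
IsSegmentedPermutation w =
  Unique (letters w) × (∀ i → toℕ i ≡ 0 → i ∈ starts w)

isSegmentedPermutation? : Decidable (IsSegmentedPermutation {n})
isSegmentedPermutation? w =
  AllPairs.allPairs? (λ x y → ¬? (x Fin.≟ y)) (letters w)
  ×-dec Fin.all? (λ i → (toℕ i ℕ.≟ 0) →-dec (i ∈? starts w))

segmentedPermutations : (n : ℕ) → List (SegmentedWord n)
segmentedPermutations n =
  filter isSegmentedPermutation?
    (cartesianProductWith segmented
      (words (allFin n) n) (words (inside ∷ outside ∷ []) n))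

infix 4 _⋖_ _⋖?_ _≟ˢ_

_⋖_ : Fin n → Fin n → Set
i ⋖ j = toℕ j ≡ suc (toℕ i)

_⋖?_ : (i j : Fin n) → Dec (i ⋖ j)
i ⋖? j = toℕ j ℕ.≟ suc (toℕ i)

-- Adjacent positions lie in the same block exactly when the second one does
-- not start a block.
IsAscent IsDescent : SegmentedWord n → Fin n → Set
IsAscent  w i = ∃ λ j → i ⋖ j × j ∉ starts w × σ w i < σ w j
IsDescent w i = ∃ λ j → i ⋖ j × j ∉ starts w × σ w j < σ w i

isAscent? : (w : SegmentedWord n) → Decidable (IsAscent w)
isAscent? w i =
  Fin.any? λ j → (i ⋖? j) ×-dec ¬? (j ∈? starts w) ×-dec (σ w i <? σ w j)

isDescent? : (w : SegmentedWord n) → Decidable (IsDescent w)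
isDescent? w i =
  Fin.any? λ j → (i ⋖? j) ×-dec ¬? (j ∈? starts w) ×-dec (σ w j <? σ w i)

ascents descents : SegmentedWord n → ℕ
ascents  w = count (isAscent?  w) (allFin _)
descents w = count (isDescent? w) (allFin _)

SW : (n k ℓ : ℕ) → List (SegmentedWord n)
SW n k ℓ =
  filter (λ w → (ascents w ℕ.≟ k) ×-dec (descents w ℕ.≟ ℓ))
    (segmentedPermutations n)

IsSminversion : SegmentedWord n → Fin n × Fin n → Set
IsSminversion w (i , j) =
  i < j × σ w j < σ w i ×
  (j ∈ starts w ⊎ ∃ λ p → p ⋖ j × σ w i < σ w p)

isSminversion? : (w : SegmentedWord n) → Decidable (IsSminversion w)
isSminversion? w (i , j) =
  (i <? j) ×-dec (σ w j <? σ w i) ×-dec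
  ((j ∈? starts w) ⊎-dec
   Fin.any? (λ p → (p ⋖? j) ×-dec (σ w i <? σ w p)))

sminv : SegmentedWord n → ℕ
sminv w = count (isSminversion? w) (cartesianProduct (allFin _) (allFin _))

-- The subscript i of a decoration θᵢ, ξᵢ is the position of the step, so
-- only the kind of decoration is recorded.
data Step : Set where
  up      : Step
  level-θ : Step
  level-ξ : Step
  down-θξ : Step

displacement : Step → ℤ × ℤ
displacement up      = 1ℤ , 1ℤ
displacement level-θ = 1ℤ , 0ℤ
displacement level-ξ = 1ℤ , 0ℤ
displacement down-θξ = 1ℤ , -1ℤ

θ-decorated ξ-decorated : Step → Side
θ-decorated up      = outside
θ-decorated level-θ = inside
θ-decorated level-ξ = outside
θ-decorated down-θξ = inside
ξ-decorated up      = outside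
ξ-decorated level-θ = outside
ξ-decorated level-ξ = inside
ξ-decorated down-θξ = inside

_≟ˢ_ : (s t : Step) → Dec (s ≡ t)
up      ≟ˢ up      = yes refl
up      ≟ˢ level-θ = no λ ()
up      ≟ˢ level-ξ = no λ ()
up      ≟ˢ down-θξ = no λ ()
level-θ ≟ˢ up      = no λ ()
level-θ ≟ˢ level-θ = yes refl
level-θ ≟ˢ level-ξ = no λ ()
level-θ ≟ˢ down-θξ = no λ ()
level-ξ ≟ˢ up      = no λ ()
level-ξ ≟ˢ level-θ = no λ ()
level-ξ ≟ˢ level-ξ = yes refl
level-ξ ≟ˢ down-θξ = no λ ()
down-θξ ≟ˢ up      = no λ ()
down-θξ ≟ˢ level-θ = no λ ()
down-θξ ≟ˢ level-ξ = no λ ()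
down-θξ ≟ˢ down-θξ = yes refl

-- The lattice points reached after each step; the starting point itself is
-- not listed.
verticesFrom : ℤ × ℤ → Vec Step n → Vec (ℤ × ℤ) n
verticesFrom _       []      = []
verticesFrom (x , y) (s ∷ π) = z ∷ verticesFrom z π
  where z = x ℤ.+ proj₁ (displacement s) , y ℤ.+ proj₂ (displacement s)

vertices : Vec Step n → Vec (ℤ × ℤ) n
vertices = verticesFrom (0ℤ , 0ℤ)

IsModifiedMotzkin : Vec Step n → Set
IsModifiedMotzkin π =
  (∀ i → toℕ i ≡ 0 → lookup π i ≡ up) ×
  All (λ z → 1ℤ ℤ.≤ proj₂ z) (vertices π)

isModifiedMotzkin? : Decidable (IsModifiedMotzkin {n})
isModifiedMotzkin? π =
  Fin.all? (λ i → (toℕ i ℕ.≟ 0) →-dec (lookup π i ≟ˢ up))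
  ×-dec All.all? (λ z → 1ℤ ℤ.≤? proj₂ z) (vertices π)

Π>0 : (n : ℕ) → List (Vec Step n)
Π>0 n =
  filter isModifiedMotzkin?
    (words (up ∷ level-θ ∷ level-ξ ∷ down-θξ ∷ []) n)

T S : Vec Step n → Subset n
T = Vec.map θ-decorated
S = Vec.map ξ-decorated

degθ degξ : Vec Step n → ℕ
degθ π = ∣ T π ∣
degξ π = ∣ S π ∣

χ : Bool → ℤ
χ b = if b then 1ℤ else 0ℤ

-- αFrom a T S lists the values that the recurrence produces after a.
-- A subset is its vector of sides, so χ (not t) is χ(i ∉ T).
αFrom : ℤ → Subset n → Subset n → Vec ℤ n
αFrom a []      []      = []
αFrom a (t ∷ T) (s ∷ S) = a′ ∷ αFrom a′ T S
  where a′ = a ℤ.- 1ℤ ℤ.+ χ (not t) ℤ.+ χ (not s)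

-- The initial value does not depend on T and S, which are meant to be
-- subsets of {2, …, n}.
α : Subset n → Subset n → Vec ℤ n
α []      []      = []
α (_ ∷ T) (_ ∷ S) = 0ℤ ∷ αFrom 0ℤ T S

-- A polynomial identity with natural coefficients is read as an identity
-- between arbitrary elements q, u, v of an arbitrary commutative semiring;
-- in the polynomial semiring these can be taken to be the indeterminates.
module GeneratingFunctions {c ℓ} (R : CommutativeSemiring c ℓ) where

  open CommutativeSemiring R
  open import Algebra.Definitions.RawSemiring rawSemiring
    using (_^_; sum; product)

  infix 5 ∑-list
  ∑-list : {A : Set} → List A → (A → Carrier) → Carrier
  ∑-list xs f = foldr (λ x s → f x + s) 0# xs

  syntax ∑-list xs (λ x → e) = ∑[ x ← xs ] e

  -- [m]_q = 1 + q + ⋯ + q^(m-1).  The value at negative m is a convention;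
  -- it plays no role for paths, along which αᵢ + 1 is the height after i steps.
  [_]⟨_⟩ : ℤ → Carrier → Carrier
  [ ℤ.+ m      ]⟨ q ⟩ = sum {m} (λ i → q ^ toℕ i)
  [ ℤ.-[1+ m ] ]⟨ q ⟩ = 0#

  stair : Carrier → Vec Step n → Carrier
  stair {n} q π =
    product {n} (λ i → [ lookup (α (T π) (S π)) i ℤ.+ 1ℤ ]⟨ q ⟩)

  segmentedSide : (n : ℕ) (q u v : Carrier) → Carrier
  segmentedSide n q u v =
    ∑[ kℓ ← filter (λ kℓ → (proj₁ kℓ ℕ.+ proj₂ kℓ) ℕ.<? n)
                   (cartesianProduct (upTo n) (upTo n)) ]
      (u ^ proj₁ kℓ * v ^ proj₂ kℓ
        * (∑[ w ← SW n (proj₁ kℓ) (proj₂ kℓ) ] (q ^ sminv w)))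

  pathSide : (n : ℕ) (q u v : Carrier) → Carrier
  pathSide n q u v =
    ∑[ π ← Π>0 n ] (u ^ degθ π * v ^ degξ π * stair q π)

{-# OPTIONS --safe #-}

-- Both sides satisfy the same transfer recursion in h, the number of blocks
-- on the left and the height on the right.  Inserting a new maximal letter
-- into a segmented permutation creates a new block (an up-step), is appended
-- to a block (θ, one more ascent), is prepended to a block (ξ, one more
-- descent), or joins two adjacent blocks (θξ).  If h blocks result, there are
-- h places for it, and it adds as many sminversions as blocks start to its
-- right, that is 0, …, h - 1, whence the factor [h]_q.  A path that returns
-- to the line y = 0 contributes nothing to the recursion, as [0]_q = 0.

module Submission where

open import Defs
open import Algebra.Bundles using (CommutativeSemiring)
open import Data.Bool.Base
  using (Bool; true; false; not; _∧_; _∨_; if_then_else_) renaming (T to IsTrue)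
open import Data.Bool.Properties using (T?; ∨-zeroʳ; ∧-zeroʳ)
open import Data.Empty using (⊥)
open import Data.Fin.Base as Fin using (Fin; zero; suc; toℕ; fromℕ<)
open import Data.Fin.Properties as Fin
  using (toℕ<n; toℕ-fromℕ<; toℕ-injective; injective⇒≤; fromℕ<-injective)
open import Data.Fin.Subset using (Subset) renaming (_∈_ to _∈ˢ_; _∉_ to _∉ˢ_)
open import Data.Fin.Subset.Properties using (drop-there)
open import Data.Integer.Base as ℤ using (ℤ; 0ℤ; 1ℤ)
import Data.Integer.Properties as ℤ
open import Data.List.Base as List
  using (List; []; _∷_; _++_; length; filter; tabulate; allFin; upTo; concatMap;
         cartesianProduct; cartesianProductWith)
import Data.List.Properties as List
open import Data.List.Membership.Propositional using (_∈_; find; lose)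
open import Data.List.Membership.Propositional.Properties
  using (∈-++⁺ʳ; ∈-++⁻; ∈-map⁺; ∈-map⁻; ∈-concatMap⁺; ∈-concatMap⁻; ∈-filter⁺; ∈-filter⁻;
         ∈-allFin; ∈-upTo⁺; ∈-cartesianProduct⁺; ∈-cartesianProductWith⁺)
open import Data.List.Membership.Propositional.Properties.WithK using (unique∧set⇒bag)
open import Data.List.Relation.Binary.BagAndSetEquality using (∼bag⇒↭)
open import Data.List.Relation.Binary.Permutation.Propositional as ↭ using (_↭_)
open import Data.List.Relation.Unary.Any using (here; there)
import Data.List.Relation.Unary.All as ListAll
import Data.List.Relation.Unary.All.Properties as ListAll
import Data.List.Relation.Unary.AllPairs as ListAllPairs
import Data.List.Relation.Unary.AllPairs.Properties as ListAllPairs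
open import Data.List.Relation.Unary.Unique.Propositional using () renaming (Unique to UniqueList)
import Data.List.Relation.Unary.Unique.Propositional.Properties as UniqueList
open import Data.Nat.Base as ℕ
  using (ℕ; zero; suc; _<_; _≤_; _<ᵇ_; _∸_; s≤s; z≤n; NonZero)
import Data.Nat.ListAction as ℕ
import Data.Nat.Properties as ℕ
open import Data.Product.Base using (_×_; _,_; proj₁; proj₂; ∃)
open import Data.Sum.Base using (_⊎_; inj₁; inj₂)
open import Data.Vec.Base as Vec using (Vec; []; _∷_; lookup)
open import Data.Vec.Membership.DecPropositional ℕ._≟_ using () renaming (_∈?_ to _∈ᵛ?_)
open import Data.Vec.Membership.Propositional using () renaming (_∈_ to _∈ᵛ_)
import Data.Vec.Properties as Vec
open import Data.Vec.Relation.Unary.All as All using (All; []; _∷_)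
import Data.Vec.Relation.Unary.All.Properties as All
open import Data.Vec.Relation.Unary.AllPairs as AllPairs using ([]; _∷_)
open import Data.Vec.Relation.Unary.Any using () renaming (here to hereᵛ; there to thereᵛ)
open import Data.Vec.Relation.Unary.Unique.Propositional using (Unique)
import Data.Vec.Relation.Unary.Unique.Propositional.Properties as Unique
open import Function.Base using (_∘_; _$_; id)
open import Function.Bundles using (_⇔_; mk⇔; Equivalence)
open import Relation.Binary.PropositionalEquality as ≡
  using (_≡_; _≢_; cong; cong₂; subst)
open import Relation.Nullary using (¬_; Dec; yes; no; does; contradiction)
open import Relation.Nullary.Decidable
  using (does-⇔; dec-true; dec-false; decidable-stable; map′; ¬?; _×-dec_; _⊎-dec_; _→-dec_)
open import Relation.Unary using (Decidable)

-- The given list of segmented permutations and the list built by insertions are different lists.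
-- Matching them needs that every arrangement arises from exactly one insertion, and deleting the
-- maximal letter provides this. The sums are computed along the letters of a single vector. That
-- recursion passes to tails, whose first letter need not start a block and has a predecessor
-- outside the vector. Hence arrangements may open with an unmarked letter, the statistics take the
-- preceding letter as an argument, and the sum over insertions into a tail has brackets of its own,
-- with one place more for θ and for θξ. The recursion of the overview appears only once the leading
-- letter is accounted for. The number of blocks enters through an arbitrary function `K`. Taking
-- for `K` the sum over all continuations of a path turns the largest letter into one further step,
-- so no bijection between permutations and paths has to be constructed.

private variable
  n m N : ℕ
  A B C : Set

-- The letter at a position, and whether a block starts there.
Letter : Set
Letter = ℕ × Bool

values : Vec Letter n → Vec ℕ n
values = Vec.map proj₁

-- Inserting a maximal letter

-- N may only be inserted in front of a letter that starts a block (or at the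
-- end), because deleting a maximal letter makes its successor start a block.
-- A leading letter that does not start a block is allowed here; headedWeight
-- discards such arrangements.
heads : ℕ → Letter → Vec Letter n → List (Vec Letter (suc (suc n)))
heads N (y , false) r = []
heads N (y , true)  r =
  ((N , true)  ∷ (y , true)  ∷ r) ∷ ((N , false) ∷ (y , true)  ∷ r) ∷
  ((N , true)  ∷ (y , false) ∷ r) ∷ ((N , false) ∷ (y , false) ∷ r) ∷ []

insertions : ℕ → Vec Letter n → List (Vec Letter (suc n))
insertions N []      = ((N , true) ∷ []) ∷ ((N , false) ∷ []) ∷ []
insertions N (x ∷ r) = heads N x r ++ List.map (x ∷_) (insertions N r)

arrangements : (n : ℕ) → List (Vec Letter n)
arrangements zero    = [] ∷ []
arrangements (suc n) = concatMap (insertions n) (arrangements n)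

delete : ℕ → Vec Letter (suc n) → Vec Letter n
-- The last letter is dropped without a test: if `N` occurs and has not been met before, it stands
-- here.
delete {zero}  N _ = []
delete {suc n} N (x ∷ y ∷ r) with proj₁ x ℕ.≟ N
... | yes _ = (proj₁ y , true) ∷ r
... | no  _ = x ∷ delete N (y ∷ r)

-- Every arrangement arises from exactly one insertion

Arrangement : ℕ → Vec Letter n → Set
Arrangement N r = Unique (values r) × All (_< N) (values r)

-- Treats the four insertions in front of `y` at once, with both marks as variables; the equation
-- records that `y` started a block before.
heads-elim : (P : Vec Letter (suc (suc n)) → Set) (y : Letter) (r : Vec Letter n) →
  (∀ s → proj₂ y ≡ true → ∀ t → P ((N , s) ∷ (proj₁ y , t) ∷ r)) →
  ∀ {r′} → r′ ∈ heads N y r → P r′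
heads-elim P (y , true) r h (here ≡.refl) = h true ≡.refl true
heads-elim P (y , true) r h (there (here ≡.refl)) = h false ≡.refl true
heads-elim P (y , true) r h (there (there (here ≡.refl))) = h true ≡.refl false
heads-elim P (y , true) r h (there (there (there (here ≡.refl)))) = h false ≡.refl false

∈-insertions-[] : (s : Bool) → ((N , s) ∷ []) ∈ insertions N []
∈-insertions-[] true  = here ≡.refl
∈-insertions-[] false = there (here ≡.refl)

∈-heads : ∀ s y t (r : Vec Letter n) → ((N , s) ∷ (y , t) ∷ r) ∈ insertions N ((y , true) ∷ r)
∈-heads true  y true  r = here ≡.refl
∈-heads false y true  r = there (here ≡.refl)
∈-heads true  y false r = there (there (here ≡.refl))
∈-heads false y false r = there (there (there (here ≡.refl)))

insertions-delete : (r : Vec Letter (suc n)) → N ∈ᵛ values r → r ∈ insertions N (delete N r)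
insertions-delete {zero}  ((_ , s) ∷ []) (hereᵛ ≡.refl) = ∈-insertions-[] s
insertions-delete {suc n} {N} (x ∷ y ∷ r) o with proj₁ x ℕ.≟ N
insertions-delete {suc n} (x ∷ y ∷ r) o           | yes ≡.refl = ∈-heads _ _ _ r
insertions-delete {suc n} (x ∷ y ∷ r) (hereᵛ N≡x) | no x≢N = contradiction (≡.sym N≡x) x≢N
insertions-delete {suc n} (x ∷ y ∷ r) (thereᵛ o)  | no x≢N =
  ∈-++⁺ʳ (heads _ x _) (∈-map⁺ (x ∷_) (insertions-delete (y ∷ r) o))

insertions-All : ∀ {P : ℕ → Set} {r : Vec Letter n} → P N → All P (values r) →
  ∀ {r′} → r′ ∈ insertions N r → All P (values r′)
insertions-All {r = []} pN [] (here ≡.refl) = pN ∷ []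
insertions-All {r = []} pN [] (there (here ≡.refl)) = pN ∷ []
insertions-All {N = N} {P} {r = x ∷ r} pN (px ∷ pr) r′∈ with ∈-++⁻ (heads N x r) r′∈
... | inj₁ h = heads-elim (All P ∘ values) x r (λ _ _ _ → pN ∷ px ∷ pr) h
... | inj₂ m with ∈-map⁻ (x ∷_) m
...   | _ , r″∈ , ≡.refl = px ∷ insertions-All pN pr r″∈

insertions-Unique : {r : Vec Letter n} → All (N ≢_) (values r) → Unique (values r) →
  ∀ {r′} → r′ ∈ insertions N r → Unique (values r′)
insertions-Unique {r = []} _ _ (here ≡.refl) = [] ∷ []
insertions-Unique {r = []} _ _ (there (here ≡.refl)) = [] ∷ []
insertions-Unique {N = N} {r = x ∷ r} (N≢x ∷ N≢r) (x≢ ∷ u) r′∈ with ∈-++⁻ (heads N x r) r′∈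
... | inj₁ h = heads-elim (Unique ∘ values) x r (λ _ _ _ → (N≢x ∷ N≢r) ∷ x≢ ∷ u) h
... | inj₂ m with ∈-map⁻ (x ∷_) m
...   | _ , r″∈ , ≡.refl = insertions-All (N≢x ∘ ≡.sym) x≢ r″∈ ∷ insertions-Unique N≢r u r″∈

<⇒all≢ : {xs : Vec ℕ n} → All (_< N) xs → All (N ≢_) xs
<⇒all≢ = All.map (λ x<N → ℕ.<⇒≢ x<N ∘ ≡.sym)

insertions-Arrangement : {r : Vec Letter n} → Arrangement N r →
  ∀ {r′} → r′ ∈ insertions N r → Arrangement (suc N) r′
insertions-Arrangement (u , b) r′∈ =
  insertions-Unique (<⇒all≢ b) u r′∈ ,
  insertions-All (ℕ.n<1+n _) (All.map ℕ.m<n⇒m<1+n b) r′∈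

-- Makes insertions into different vectors disjoint: a common result would be deleted to both. This
-- keeps `arrangements` free of repetitions.
delete-insertions : {r : Vec Letter n} → All (N ≢_) (values r) →
  ∀ {r′} → r′ ∈ insertions N r → delete N r′ ≡ r
delete-insertions {r = []} _ _ = ≡.refl
delete-insertions {N = N} {r = x ∷ r} (N≢x ∷ N≢r) r′∈ with ∈-++⁻ (heads N x r) r′∈
... | inj₁ h = heads-elim (λ r′ → delete N r′ ≡ x ∷ r) x r lem h
  where
  lem : ∀ s → proj₂ x ≡ true → ∀ t → delete N ((N , s) ∷ (proj₁ x , t) ∷ r) ≡ x ∷ r
  lem s eq t with N ℕ.≟ N
  ... | yes _ = cong (λ s → (proj₁ x , s) ∷ r) (≡.sym eq)
  ... | no N≢N = contradiction ≡.refl N≢N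
... | inj₂ m with ∈-map⁻ (x ∷_) m
...   | (y ∷ r″) , r″∈ , ≡.refl with proj₁ x ℕ.≟ N
...     | yes x≡N = contradiction (≡.sym x≡N) N≢x
...     | no _ = cong (x ∷_) (delete-insertions N≢r r″∈)

insertions-UniqueList : {r : Vec Letter n} → All (N ≢_) (values r) → UniqueList (insertions N r)
insertions-UniqueList {r = []} _ =
  ((λ ()) ListAll.∷ ListAll.[]) ListAllPairs.∷ ListAll.[] ListAllPairs.∷ ListAllPairs.[]
insertions-UniqueList {N = N} {r = x ∷ r} (N≢x ∷ N≢r) =
  UniqueList.++⁺ (heads-Unique x)
    (UniqueList.map⁺ Vec.∷-injectiveʳ (insertions-UniqueList N≢r)) disjoint
  where
  heads-Unique : ∀ x → UniqueList (heads N x r)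
  heads-Unique (y , false) = ListAllPairs.[]
  heads-Unique (y , true)  =
    ((λ ()) ListAll.∷ (λ ()) ListAll.∷ (λ ()) ListAll.∷ ListAll.[]) ListAllPairs.∷
    ((λ ()) ListAll.∷ (λ ()) ListAll.∷ ListAll.[]) ListAllPairs.∷
    ((λ ()) ListAll.∷ ListAll.[]) ListAllPairs.∷
    ListAll.[] ListAllPairs.∷ ListAllPairs.[]
  disjoint : ∀ {r′} → ¬ (r′ ∈ heads N x r × r′ ∈ List.map (x ∷_) (insertions N r))
  disjoint (h , m) with ∈-map⁻ (x ∷_) m
  ... | r″ , _ , ≡.refl =
    heads-elim (λ r′ → ¬ r′ ≡ x ∷ r″) x r
      (λ _ _ _ eq → N≢x (cong proj₁ (Vec.∷-injectiveˡ eq))) h ≡.refl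

arrangements-sound : {r : Vec Letter n} → r ∈ arrangements n → Arrangement n r
arrangements-sound {zero} {[]} _ = [] , []
arrangements-sound {suc n} r∈ with find (∈-concatMap⁻ (insertions n) {xs = arrangements n} r∈)
... | r₀ , r₀∈ , r∈′ = insertions-Arrangement (arrangements-sound r₀∈) r∈′

arrangements-UniqueList : (n : ℕ) → UniqueList (arrangements n)
arrangements-UniqueList zero    = ListAll.[] ListAllPairs.∷ ListAllPairs.[]
arrangements-UniqueList (suc n) = UniqueList.concat⁺
  (ListAll.map⁺ (ListAll.tabulate (λ r∈ → insertions-UniqueList (fresh r∈))))
  (ListAllPairs.map⁺ (pairs (λ r∈ → r∈) (arrangements-UniqueList n)))
  where
  fresh : ∀ {r} → r ∈ arrangements n → All (n ≢_) (values r)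
  fresh r∈ = <⇒all≢ (proj₂ (arrangements-sound r∈))
  pairs : ∀ {rs} → (∀ {r} → r ∈ rs → r ∈ arrangements n) → UniqueList rs →
    ListAllPairs.AllPairs (λ r s → ∀ {r′} → ¬ (r′ ∈ insertions n r × r′ ∈ insertions n s)) rs
  pairs _ ListAllPairs.[] = ListAllPairs.[]
  pairs ⊆ (r≢ ListAllPairs.∷ u) =
    ListAll.tabulate (λ s∈ (r′∈r , r′∈s) → ListAll.lookup r≢ s∈
      (≡.trans (≡.sym (delete-insertions (fresh (⊆ (here ≡.refl))) r′∈r))
               (delete-insertions (fresh (⊆ (there s∈))) r′∈s)))
    ListAllPairs.∷ pairs (⊆ ∘ there) u

delete-All : ∀ {P : ℕ → Set} (r : Vec Letter (suc n)) →
  All P (values r) → All P (values (delete N r))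
delete-All {zero}  r _ = []
delete-All {suc n} {N} (x ∷ y ∷ r) (px ∷ py ∷ pr) with proj₁ x ℕ.≟ N
... | yes _ = py ∷ pr
... | no  _ = px ∷ delete-All (y ∷ r) (py ∷ pr)

delete-Unique : (r : Vec Letter (suc n)) → Unique (values r) → Unique (values (delete N r))
delete-Unique {zero}  r _ = []
delete-Unique {suc n} {N} (x ∷ y ∷ r) (x≢ ∷ u) with proj₁ x ℕ.≟ N
... | yes _ with u
...   | v ∷ w = v ∷ w
delete-Unique {suc n} {N} (x ∷ y ∷ r) (x≢ ∷ u) | no  _ =
  delete-All (y ∷ r) x≢ ∷ delete-Unique (y ∷ r) u

delete-≢ : (r : Vec Letter (suc n)) → Unique (values r) → N ∈ᵛ values r →
  All (N ≢_) (values (delete N r))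
delete-≢ {zero}  r _ _ = []
delete-≢ {suc n} {N} (x ∷ y ∷ r) (x≢ ∷ u) o with proj₁ x ℕ.≟ N
delete-≢ (x ∷ y ∷ r) ((x≢y ∷ x≢r) ∷ _) _  | yes ≡.refl = x≢y ∷ x≢r
delete-≢ (x ∷ y ∷ r) (x≢ ∷ u) (hereᵛ N≡x) | no x≢N = contradiction (≡.sym N≡x) x≢N
delete-≢ (x ∷ y ∷ r) (x≢ ∷ u) (thereᵛ o)  | no x≢N = (x≢N ∘ ≡.sym) ∷ delete-≢ (y ∷ r) u o

bounded-Unique⇒≤ : (xs : Vec ℕ n) → All (_< N) xs → Unique xs → n ≤ N
bounded-Unique⇒≤ {n} {N} xs b u = injective⇒≤ {f = f} λ {i} {j} eq →
  Unique.lookup-injective u i j (fromℕ<-injective _ _ _ _ eq)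
  where
  f : Fin n → Fin N
  f i = fromℕ< (All.lookup⁺ b i)

sharpen-bound : ∀ {m} {xs : Vec ℕ m} → All (_< suc n) xs → All (n ≢_) xs → All (_< n) xs
sharpen-bound b n≢ = All.map
  (λ (m<sn , n≢m) → ℕ.≤∧≢⇒< (ℕ.<⇒≤pred m<sn) (n≢m ∘ ≡.sym)) (All.zip (b , n≢))

∉⇒All≢ : (xs : Vec ℕ n) → ¬ N ∈ᵛ xs → All (N ≢_) xs
∉⇒All≢ []       _  = []
∉⇒All≢ (x ∷ xs) N∉ = (N∉ ∘ hereᵛ) ∷ ∉⇒All≢ xs (N∉ ∘ thereᵛ)

-- Otherwise n + 1 distinct letters would all lie below `n`, against the pigeonhole principle.
maximum-occurs : (r : Vec Letter (suc n)) → Arrangement (suc n) r → n ∈ᵛ values r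
maximum-occurs {n} r (u , b) = decidable-stable (n ∈ᵛ? values r) λ n∉ →
  ℕ.1+n≰n (bounded-Unique⇒≤ (values r) (sharpen-bound b (∉⇒All≢ _ n∉)) u)

arrangements-complete : (r : Vec Letter n) → Arrangement n r → r ∈ arrangements n
arrangements-complete {zero}  [] _ = here ≡.refl
arrangements-complete {suc n} r a@(u , b) = ∈-concatMap⁺ (insertions n)
  (lose (arrangements-complete (delete n r) (delete-Unique r u , bounded))
        (insertions-delete r o))
  where
  o = maximum-occurs r a
  bounded = sharpen-bound (delete-All r b) (delete-≢ r u o)

-- Segmented words as vectors of letters

encodeWith : Vec (Fin m) n → Subset n → Vec Letter n
encodeWith V s = Vec.zip (Vec.map toℕ V) s

encode : SegmentedWord n → Vec Letter n
encode w = encodeWith (letters w) (starts w)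

headed : Vec Letter n → Bool
headed []            = true
headed ((_ , s) ∷ _) = s

values-encode : (V : Vec (Fin m) n) (s : Subset n) → values (encodeWith V s) ≡ Vec.map toℕ V
values-encode V s = Vec.map-proj₁-zip (Vec.map toℕ V) s

map-toℕ-injective : (V V′ : Vec (Fin m) n) → Vec.map toℕ V ≡ Vec.map toℕ V′ → V ≡ V′
map-toℕ-injective []      []        _  = ≡.refl
map-toℕ-injective (x ∷ V) (x′ ∷ V′) eq = cong₂ _∷_
  (toℕ-injective (Vec.∷-injectiveˡ eq)) (map-toℕ-injective V V′ (Vec.∷-injectiveʳ eq))

encode-injective : {w w′ : SegmentedWord n} → encode w ≡ encode w′ → w ≡ w′
encode-injective {w = segmented V s} {segmented V′ s′} eq = cong₂ segmented
  (map-toℕ-injective V V′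
    (≡.trans (≡.sym (values-encode V s)) (≡.trans (cong values eq) (values-encode V′ s′))))
  (≡.trans (≡.sym (Vec.map-proj₂-zip _ s))
    (≡.trans (cong (Vec.map proj₂) eq) (Vec.map-proj₂-zip _ s′)))

decodeLetters : (r : Vec Letter n) → All (_< m) (values r) → Vec (Fin m) n
decodeLetters []      []       = []
decodeLetters (x ∷ r) (p ∷ ps) = fromℕ< p ∷ decodeLetters r ps

encode-decode : (r : Vec Letter n) (b : All (_< m) (values r)) →
  encodeWith (decodeLetters r b) (Vec.map proj₂ r) ≡ r
encode-decode []      []       = ≡.refl
encode-decode (x ∷ r) (p ∷ ps) =
  cong₂ _∷_ (cong (_, proj₂ x) (toℕ-fromℕ< p)) (encode-decode r ps)

Unique-map⁻ : (V : Vec (Fin m) n) → Unique (Vec.map toℕ V) → Unique V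
Unique-map⁻ V u = AllPairs.map (_∘ cong toℕ) (AllPairs⁻ V u)
  where
  AllPairs⁻ : ∀ {n} (V : Vec (Fin m) n) → Unique (Vec.map toℕ V) →
    AllPairs.AllPairs (λ x y → toℕ x ≢ toℕ y) V
  AllPairs⁻ []      AllPairs.[] = AllPairs.[]
  AllPairs⁻ (x ∷ V) (p AllPairs.∷ ps) = All.map⁻ p AllPairs.∷ AllPairs⁻ V ps

all-toℕ< : (V : Vec (Fin m) n) → All (_< m) (Vec.map toℕ V)
all-toℕ< []      = []
all-toℕ< (x ∷ V) = toℕ<n x ∷ all-toℕ< V

encode-sound : {w : SegmentedWord n} → IsSegmentedPermutation w →
  Arrangement n (encode w) × IsTrue (headed (encode w))
encode-sound {w = segmented V s} (u , h) =
  subst (λ xs → Unique xs × All (_< _) xs) (≡.sym (values-encode V s))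
    (Unique.map⁺ toℕ-injective u , all-toℕ< V) , head V s h
  where
  head : ∀ {n} (V : Vec (Fin m) n) s → (∀ i → toℕ i ≡ 0 → i ∈ˢ s) →
    IsTrue (headed (encodeWith V s))
  head []      []      _ = _
  head (x ∷ V) (t ∷ s) h with Vec.here ← h zero ≡.refl = _

decode-sound : (r : Vec Letter n) → Arrangement n r → IsTrue (headed r) →
  ∃ λ w → IsSegmentedPermutation w × r ≡ encode w
decode-sound {n} r (u , b) h = w , (Unique-map⁻ _ (subst Unique eq u) , first r h) ,
  ≡.sym (encode-decode r b)
  where
  w = segmented (decodeLetters r b) (Vec.map proj₂ r)
  eq : values r ≡ Vec.map toℕ (letters w)
  eq = ≡.trans (cong values (≡.sym (encode-decode r b))) (values-encode (letters w) _)
  first : ∀ {n} (r : Vec Letter n) → IsTrue (headed r) → ∀ i → toℕ i ≡ 0 → i ∈ˢ Vec.map proj₂ r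
  first ((_ , true) ∷ r) _ zero _ = Vec.here

words-complete : (xs : List A) → (∀ x → x ∈ xs) → (v : Vec A n) → v ∈ words xs n
words-complete xs c []      = here ≡.refl
words-complete xs c (x ∷ v) = ∈-cartesianProductWith⁺ _∷_ (c x) (words-complete xs c v)

words-UniqueList : {xs : List A} → UniqueList xs → ∀ n → UniqueList (words xs n)
words-UniqueList u zero    = ListAll.[] ListAllPairs.∷ ListAllPairs.[]
words-UniqueList u (suc n) =
  UniqueList.cartesianProductWith⁺ _∷_ Vec.∷-injective u (words-UniqueList u n)

∈-sides : (s : Bool) → s ∈ (true ∷ false ∷ [])
∈-sides true  = here ≡.refl
∈-sides false = there (here ≡.refl)

segmentedWords : ∀ n → List (SegmentedWord n)
segmentedWords n = List.cartesianProductWith segmented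
  (words (allFin n) n) (words (true ∷ false ∷ []) n)

segmentedPermutations-complete : {w : SegmentedWord n} → IsSegmentedPermutation w →
  w ∈ segmentedPermutations n
segmentedPermutations-complete {w = segmented V s} p = ∈-filter⁺ isSegmentedPermutation?
  (∈-cartesianProductWith⁺ segmented
    (words-complete (allFin _) ∈-allFin V) (words-complete _ ∈-sides s)) p

segmentedPermutations-UniqueList : ∀ n → UniqueList (segmentedPermutations n)
segmentedPermutations-UniqueList n = UniqueList.filter⁺ isSegmentedPermutation?
  (UniqueList.cartesianProductWith⁺ segmented (λ { ≡.refl → ≡.refl , ≡.refl })
    (words-UniqueList (UniqueList.allFin⁺ n) n)
    (words-UniqueList
      (((λ ()) ListAll.∷ ListAll.[]) ListAllPairs.∷ ListAll.[] ListAllPairs.∷ ListAllPairs.[]) n))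

-- Neither list has repetitions and they have the same elements, so they agree as bags. That is
-- enough for sums in a commutative semiring.
segmentedPermutations↭ : ∀ n → List.map encode (segmentedPermutations n) ↭
  filter (T? ∘ headed) (arrangements n)
segmentedPermutations↭ n = ∼bag⇒↭ $ unique∧set⇒bag
  (UniqueList.map⁺ encode-injective (segmentedPermutations-UniqueList n))
  (UniqueList.filter⁺ (T? ∘ headed) (arrangements-UniqueList n))
  (mk⇔ to from)
  where
  to : ∀ {r} → r ∈ List.map encode (segmentedPermutations n) →
    r ∈ filter (T? ∘ headed) (arrangements n)
  to r∈ with ∈-map⁻ encode r∈
  ... | w , w∈ , ≡.refl with encode-sound
      (proj₂ (∈-filter⁻ isSegmentedPermutation? {xs = segmentedWords n} w∈))
  ...   | a , h = ∈-filter⁺ (T? ∘ headed) (arrangements-complete _ a) h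
  from : ∀ {r} → r ∈ filter (T? ∘ headed) (arrangements n) →
    r ∈ List.map encode (segmentedPermutations n)
  from {r} r∈ with ∈-filter⁻ (T? ∘ headed) {xs = arrangements n} r∈
  ... | r∈′ , h with decode-sound r (arrangements-sound r∈′) h
  ...   | w , p , ≡.refl = ∈-map⁺ encode (segmentedPermutations-complete p)

-- Recursive forms of the statistics

⟦_⟧ : Bool → ℕ
⟦ b ⟧ = if b then 1 else 0

-- In adjacencies and smInvFrom, p is the letter just before r; in smInvFrom,
-- x is a letter anywhere to the left of r.
adjacencies : (ℕ → ℕ → Bool) → ℕ → Vec Letter n → ℕ
adjacencies c p []            = 0
adjacencies c p ((y , s) ∷ r) = ⟦ not s ∧ c p y ⟧ ℕ.+ adjacencies c y r

asc des : ℕ → Vec Letter n → ℕ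
asc = adjacencies _<ᵇ_
des = adjacencies (λ p y → y <ᵇ p)

smInvFrom : ℕ → ℕ → Vec Letter n → ℕ
smInvFrom x p []            = 0
smInvFrom x p ((y , s) ∷ r) = ⟦ (y <ᵇ x) ∧ (s ∨ (x <ᵇ p)) ⟧ ℕ.+ smInvFrom x y r

smInv : Vec Letter n → ℕ
smInv []            = 0
smInv ((x , _) ∷ r) = smInvFrom x x r ℕ.+ smInv r

blocks : Vec Letter n → ℕ
blocks []            = 0
blocks ((_ , s) ∷ r) = ⟦ s ⟧ ℕ.+ blocks r

count-∷ : {P : A → Set} (P? : Decidable P) (x : A) (xs : List A) →
  count P? (x ∷ xs) ≡ ⟦ does (P? x) ⟧ ℕ.+ count P? xs
count-∷ P? x xs with does (P? x)
... | true  = ≡.refl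
... | false = ≡.refl

count-map : {P : B → Set} (P? : Decidable P) (f : A → B) (xs : List A) →
  count P? (List.map f xs) ≡ count (λ x → P? (f x)) xs
count-map P? f []       = ≡.refl
count-map P? f (x ∷ xs) = begin
  count P? (f x ∷ List.map f xs)                     ≡⟨ count-∷ P? (f x) _ ⟩
  ⟦ does (P? (f x)) ⟧ ℕ.+ count P? (List.map f xs)     ≡⟨ cong (_ ℕ.+_) (count-map P? f xs) ⟩
  ⟦ does (P? (f x)) ⟧ ℕ.+ count (λ x → P? (f x)) xs    ≡⟨ count-∷ (λ x → P? (f x)) x xs ⟨
  count (λ x → P? (f x)) (x ∷ xs)                    ∎
  where open ≡.≡-Reasoning

count-cong : {P Q : A → Set} (P? : Decidable P) (Q? : Decidable Q) →
  (∀ x → P x ⇔ Q x) → ∀ xs → count P? xs ≡ count Q? xs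
count-cong P? Q? e xs = cong length (List.filter-≐ P? Q?
  ((λ {x} → Equivalence.to (e x)) , (λ {x} → Equivalence.from (e x))) xs)

count-allFin : {P : Fin (suc n) → Set} (P? : Decidable P) →
  count P? (allFin (suc n)) ≡ ⟦ does (P? zero) ⟧ ℕ.+ count (λ i → P? (suc i)) (allFin n)
count-allFin {n} P? = ≡.trans (count-∷ P? zero (tabulate suc)) (cong (_ ℕ.+_)
  (≡.trans (cong (count P?) (≡.sym (List.map-tabulate id suc))) (count-map P? suc (allFin n))))

count-++ : {P : A → Set} (P? : Decidable P) (xs ys : List A) →
  count P? (xs ++ ys) ≡ count P? xs ℕ.+ count P? ys
count-++ P? xs ys = ≡.trans (cong length (List.filter-++ P? xs ys)) (List.length-++ (filter P? xs))

count-cartesianProduct : {P : A × B → Set} (P? : Decidable P) (xs : List A) (ys : List B) →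
  count P? (cartesianProduct xs ys) ≡ ℕ.sum (List.map (λ x → count (λ y → P? (x , y)) ys) xs)
count-cartesianProduct P? []       ys = ≡.refl
count-cartesianProduct P? (x ∷ xs) ys = ≡.trans
  (count-++ P? (List.map (x ,_) ys) (cartesianProduct xs ys))
  (cong₂ ℕ._+_ (count-map P? (x ,_) ys) (count-cartesianProduct P? xs ys))

AdjacentIn : (Fin m → Fin m → Set) → Vec (Fin m) n → Subset n → Fin n → Set
AdjacentIn _~_ V s i = ∃ λ j → i ⋖ j × j ∉ˢ s × (lookup V i ~ lookup V j)

adjacent-suc : ∀ (_~_ : Fin m → Fin m → Set) {x V t} {s : Subset n} {i} →
  AdjacentIn _~_ (x ∷ V) (t ∷ s) (suc i) ⇔ AdjacentIn _~_ V s i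
adjacent-suc _ = mk⇔
  (λ { (suc j , e , j∉ , l) → j , ℕ.suc-injective e , j∉ ∘ Vec.there , l })
  (λ (j , e , j∉ , l) → suc j , cong suc e , j∉ ∘ drop-there , l)

adjacent-zero : ∀ (_~_ : Fin m → Fin m → Set) {x y t t′} {V : Vec (Fin m) n} {s} →
  AdjacentIn _~_ (x ∷ y ∷ V) (t ∷ t′ ∷ s) zero ⇔ (¬ IsTrue t′ × x ~ y)
adjacent-zero _ = mk⇔
  (λ { (suc zero , _ , j∉ , l) → (λ { t → j∉ (lem t) }) , l })
  (λ (¬t , l) → suc zero , ≡.refl , (λ { (Vec.there Vec.here) → ¬t _ }) , l)
  where
  lem : ∀ {t t′} {s : Subset n} → IsTrue t′ → suc zero ∈ˢ (t ∷ t′ ∷ s)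
  lem {t′ = true} _ = Vec.there Vec.here

-- The decision procedure is arbitrary because the one inherited by the tail is a shift of `P?`, not
-- the standard one for the shorter word. The same device serves for `count-invertsFrom` and
-- `count-sminversions`.
count-adjacent : ∀ {n} {_~_ : Fin m → Fin m → Set} (c : ℕ → ℕ → Bool)
  (_~?_ : ∀ x y → Dec (x ~ y)) → (∀ x y → does (x ~? y) ≡ c (toℕ x) (toℕ y)) →
  ∀ x (V : Vec (Fin m) n) t s (P? : Decidable (AdjacentIn _~_ (x ∷ V) (t ∷ s))) →
  count P? (allFin (suc n)) ≡ adjacencies c (toℕ x) (encodeWith V s)
count-adjacent c _~?_ e x [] t [] P? = ≡.trans (count-allFin P?)
  (cong (λ b → ⟦ b ⟧ ℕ.+ 0) (does-⇔ {B = ⊥} (mk⇔ (λ { (suc () , _) }) λ ()) (P? zero) (no id)))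
count-adjacent {_~_ = _~_} c _~?_ e x (y ∷ V) t (t′ ∷ s) P? =
  ≡.trans (count-allFin P?) (cong₂ ℕ._+_
  (cong ⟦_⟧ (≡.trans (does-⇔ (adjacent-zero _~_) (P? zero) (¬? (T? t′) ×-dec (x ~? y)))
                     (cong (not t′ ∧_) (e x y))))
  (≡.trans (count-cong (λ i → P? (suc i)) Q? (λ _ → adjacent-suc _~_) (allFin _))
           (count-adjacent c _~?_ e y V t′ s Q?)))
  where
  Q? : Decidable (AdjacentIn _~_ (y ∷ V) (t′ ∷ s))
  Q? i = map′ (Equivalence.to (adjacent-suc _~_)) (Equivalence.from (adjacent-suc _~_))
    (P? (suc i))

-- `0` stands in for the missing predecessor; the first letter starts a block and so is never
-- compared with it.
ascents-encode : (w : SegmentedWord n) → IsTrue (headed (encode w)) →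
  ascents w ≡ asc 0 (encode w)
ascents-encode (segmented [] []) _ = ≡.refl
ascents-encode w@(segmented (x ∷ V) (true ∷ s)) _ =
  count-adjacent _<ᵇ_ Fin._<?_ (λ _ _ → ≡.refl) x V true s (isAscent? w)

descents-encode : (w : SegmentedWord n) → IsTrue (headed (encode w)) →
  descents w ≡ des 0 (encode w)
descents-encode (segmented [] []) _ = ≡.refl
descents-encode w@(segmented (x ∷ V) (true ∷ s)) _ =
  count-adjacent (λ p y → y <ᵇ p) (λ x y → y Fin.<? x) (λ _ _ → ≡.refl) x V true s (isDescent? w)

-- Position j of p ∷ V is the position before position j of V.
InvertsFrom : Fin m → Fin m → Vec (Fin m) n → Subset n → Fin n → Set
InvertsFrom x p V s j = lookup V j Fin.< x ×
  (j ∈ˢ s ⊎ ∃ λ i → toℕ j ≡ toℕ i × x Fin.< lookup (p ∷ V) i)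

invertsFrom-suc : ∀ {x p y : Fin m} {V t} {s : Subset n} {j} →
  InvertsFrom x p (y ∷ V) (t ∷ s) (suc j) ⇔ InvertsFrom x y V s j
invertsFrom-suc = mk⇔
  (λ { (l , inj₁ j∈) → l , inj₁ (drop-there j∈)
     ; (l , inj₂ (suc i , e , l′)) → l , inj₂ (i , ℕ.suc-injective e , l′) })
  (λ { (l , inj₁ j∈) → l , inj₁ (Vec.there j∈)
     ; (l , inj₂ (i , e , l′)) → l , inj₂ (suc i , cong suc e , l′) })

invertsFrom-zero : ∀ {x p y : Fin m} {V t} {s : Subset n} →
  InvertsFrom x p (y ∷ V) (t ∷ s) zero ⇔ (y Fin.< x × (IsTrue t ⊎ x Fin.< p))
invertsFrom-zero {t = t} = mk⇔
  (λ { (l , inj₁ Vec.here) → l , inj₁ _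
     ; (l , inj₂ (zero , _ , l′)) → l , inj₂ l′ })
  (λ { (l , inj₁ h) → l , inj₁ (lem h)
     ; (l , inj₂ l′) → l , inj₂ (zero , ≡.refl , l′) })
  where
  lem : ∀ {t} {s : Subset n} → IsTrue t → zero ∈ˢ (t ∷ s)
  lem {t = true} _ = Vec.here

count-invertsFrom : ∀ {n} (x p : Fin m) (V : Vec (Fin m) n) s
  (P? : Decidable (InvertsFrom x p V s)) →
  count P? (allFin n) ≡ smInvFrom (toℕ x) (toℕ p) (encodeWith V s)
count-invertsFrom x p [] [] P? = ≡.refl
count-invertsFrom x p (y ∷ V) (t ∷ s) P? = ≡.trans (count-allFin P?) (cong₂ ℕ._+_
  (cong ⟦_⟧ (does-⇔ invertsFrom-zero (P? zero) ((y Fin.<? x) ×-dec (T? t ⊎-dec (x Fin.<? p)))))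
  (≡.trans (count-cong (λ i → P? (suc i)) Q? (λ _ → invertsFrom-suc) (allFin _))
           (count-invertsFrom x y V s Q?)))
  where
  Q? : Decidable (InvertsFrom x y V s)
  Q? i = map′ (Equivalence.to invertsFrom-suc) (Equivalence.from invertsFrom-suc) (P? (suc i))

SminversionIn : Vec (Fin m) n → Subset n → Fin n × Fin n → Set
SminversionIn V s (i , j) = i Fin.< j × lookup V j Fin.< lookup V i ×
  (j ∈ˢ s ⊎ ∃ λ p → p ⋖ j × lookup V i Fin.< lookup V p)

sminversion-suc : ∀ {x : Fin m} {V t} {s : Subset n} {i j} →
  SminversionIn (x ∷ V) (t ∷ s) (suc i , suc j) ⇔ SminversionIn V s (i , j)
sminversion-suc = mk⇔
  (λ { (i<j , l , inj₁ j∈) → ℕ.≤-pred i<j , l , inj₁ (drop-there j∈)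
     -- Here `j` would be the first position of `V`, but it lies to the right of `i`.
     ; (i<j , _ , inj₂ (zero , e , _)) →
         contradiction (subst (2 ≤_) e (ℕ.≤-trans (s≤s (s≤s z≤n)) i<j)) λ { (s≤s ()) }
     ; (i<j , l , inj₂ (suc p , e , l′)) → ℕ.≤-pred i<j , l , inj₂ (p , ℕ.suc-injective e , l′) })
  (λ { (i<j , l , inj₁ j∈) → s≤s i<j , l , inj₁ (Vec.there j∈)
     ; (i<j , l , inj₂ (p , e , l′)) → s≤s i<j , l , inj₂ (suc p , cong suc e , l′) })

-- The letter before the first position of `V` is `x` itself, so `x` is both the larger letter of
-- the pair and the initial predecessor.
sminversion-zero : ∀ {x : Fin m} {V t} {s : Subset n} {j} →
  SminversionIn (x ∷ V) (t ∷ s) (zero , suc j) ⇔ InvertsFrom x x V s j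
sminversion-zero = mk⇔
  (λ { (_ , l , inj₁ j∈) → l , inj₁ (drop-there j∈)
     ; (_ , l , inj₂ (p , e , l′)) → l , inj₂ (p , ℕ.suc-injective e , l′) })
  (λ { (l , inj₁ j∈) → s≤s z≤n , l , inj₁ (Vec.there j∈)
     ; (l , inj₂ (p , e , l′)) → s≤s z≤n , l , inj₂ (p , cong suc e , l′) })

sum-allFin : ∀ (f : Fin (suc n) → ℕ) →
  ℕ.sum (List.map f (allFin (suc n))) ≡ f zero ℕ.+ ℕ.sum (List.map (f ∘ suc) (allFin n))
sum-allFin f = cong (λ xs → f zero ℕ.+ ℕ.sum xs)
  (≡.trans (List.map-tabulate suc f) (≡.sym (List.map-tabulate id (f ∘ suc))))

count-sminversions : ∀ {n} (V : Vec (Fin m) n) s (P? : Decidable (SminversionIn V s)) →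
  ℕ.sum (List.map (λ i → count (λ j → P? (i , j)) (allFin n)) (allFin n)) ≡
  smInv (encodeWith V s)
count-sminversions []      []      P? = ≡.refl
count-sminversions {m} {n = suc n} (x ∷ V) (t ∷ s) P? = ≡.trans (sum-allFin row) (cong₂ ℕ._+_
  (≡.trans (≡.trans (count-allFin (λ j → P? (zero , j)))
                (cong (λ b → ⟦ b ⟧ ℕ.+ count (λ j → P? (zero , suc j)) (allFin n)) (corner zero)))
    (≡.trans (count-cong _ R? (λ _ → sminversion-zero) (allFin n)) (count-invertsFrom x x V s R?)))
  (≡.trans (cong ℕ.sum (List.map-cong lower (allFin n))) (count-sminversions V s Q?)))
  where
  row : Fin (suc n) → ℕ
  row i = count (λ j → P? (i , j)) (allFin (suc n))
  corner : ∀ i → does (P? (i , zero)) ≡ false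
  corner i = does-⇔ {B = ⊥} (mk⇔ (λ { (() , _) }) λ ()) (P? (i , zero)) (no id)
  R? : Decidable (InvertsFrom x x V s)
  R? j = map′ (Equivalence.to sminversion-zero) (Equivalence.from sminversion-zero)
    (P? (zero , suc j))
  Q? : Decidable (SminversionIn V s)
  Q? (i , j) = map′ (Equivalence.to sminversion-suc) (Equivalence.from sminversion-suc)
    (P? (suc i , suc j))
  lower : ∀ i → row (suc i) ≡ count (λ j → Q? (i , j)) (allFin n)
  lower i = ≡.trans (≡.trans (count-allFin (λ j → P? (suc i , j)))
      (cong (λ b → ⟦ b ⟧ ℕ.+ count (λ j → P? (suc i , suc j)) (allFin n)) (corner (suc i))))
    (count-cong (λ j → P? (suc i , suc j)) (λ j → Q? (i , j)) (λ _ → sminversion-suc) (allFin n))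

sminv-encode : (w : SegmentedWord n) → sminv w ≡ smInv (encode w)
sminv-encode w = ≡.trans (count-cartesianProduct (isSminversion? w) (allFin _) (allFin _))
  (count-sminversions (letters w) (starts w) (isSminversion? w))

-- The effect of an insertion on the statistics

<⇒<ᵇ≡true : ∀ {x y} → x < y → (x <ᵇ y) ≡ true
<⇒<ᵇ≡true {x} {y} = dec-true (x ℕ.<? y)

≤⇒<ᵇ≡false : ∀ {x y} → y ≤ x → (x <ᵇ y) ≡ false
≤⇒<ᵇ≡false {x} {y} y≤x = dec-false (x ℕ.<? y) (ℕ.≤⇒≯ y≤x)

-- As right end of a pair, `N` is too large to be inverted with `x`. The letter `y` behind `N`
-- started a block before, and afterwards has a predecessor above `x`; either way its pair with `x`
-- counts exactly if `y < x`.
smInvFrom-insertions : ∀ {x} p {r : Vec Letter n} → x < N →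
  ∀ {r′} → r′ ∈ insertions N r → smInvFrom x p r′ ≡ smInvFrom x p r
smInvFrom-insertions p {[]} x<N (here ≡.refl) rewrite ≤⇒<ᵇ≡false (ℕ.<⇒≤ x<N) = ≡.refl
smInvFrom-insertions p {[]} x<N (there (here ≡.refl)) rewrite ≤⇒<ᵇ≡false (ℕ.<⇒≤ x<N) = ≡.refl
smInvFrom-insertions {N = N} {x} p {(y , s) ∷ r} x<N r′∈ with ∈-++⁻ (heads N (y , s) r) r′∈
... | inj₁ h = heads-elim (λ r′ → smInvFrom x p r′ ≡ smInvFrom x p ((y , s) ∷ r)) (y , s) r lem h
  where
  lem : ∀ a → s ≡ true → ∀ b →
    smInvFrom x p ((N , a) ∷ (y , b) ∷ r) ≡ smInvFrom x p ((y , s) ∷ r)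
  lem a ≡.refl b rewrite ≤⇒<ᵇ≡false (ℕ.<⇒≤ x<N) | <⇒<ᵇ≡true x<N | ∨-zeroʳ b = ≡.refl
... | inj₂ t with ∈-map⁻ ((y , s) ∷_) t
...   | _ , r″∈ , ≡.refl = cong (_ ℕ.+_) (smInvFrom-insertions y {r} x<N r″∈)

-- No predecessor exceeds `N`, so a smaller letter to the right counts only by starting a block.
smInvFrom-maximum : ∀ {p} {r : Vec Letter n} → p ≤ N → All (_< N) (values r) →
  smInvFrom N p r ≡ blocks r
smInvFrom-maximum {r = []} _ _ = ≡.refl
smInvFrom-maximum {r = (y , true) ∷ r} p≤N (y<N ∷ r<N)
  rewrite <⇒<ᵇ≡true y<N = cong suc (smInvFrom-maximum (ℕ.<⇒≤ y<N) r<N)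
smInvFrom-maximum {r = (y , false) ∷ r} p≤N (y<N ∷ r<N)
  rewrite <⇒<ᵇ≡true y<N | ≤⇒<ᵇ≡false p≤N = smInvFrom-maximum (ℕ.<⇒≤ y<N) r<N

asc+des≤ : ∀ p (r : Vec Letter n) → asc p r ℕ.+ des p r ≤ n
asc+des≤ p [] = z≤n
asc+des≤ {suc n} p ((y , s) ∷ r) = begin
  (⟦ not s ∧ (p <ᵇ y) ⟧ ℕ.+ asc y r) ℕ.+ (⟦ not s ∧ (y <ᵇ p) ⟧ ℕ.+ des y r)
    ≡⟨ interchange ⟦ not s ∧ (p <ᵇ y) ⟧ (asc y r) _ _ ⟩
  (⟦ not s ∧ (p <ᵇ y) ⟧ ℕ.+ ⟦ not s ∧ (y <ᵇ p) ⟧) ℕ.+ (asc y r ℕ.+ des y r)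
    ≤⟨ ℕ.+-mono-≤ (step s) (asc+des≤ y r) ⟩
  suc n ∎
  where
  open ℕ.≤-Reasoning
  open import Algebra.Properties.CommutativeSemigroup ℕ.+-commutativeSemigroup using (interchange)
  step : ∀ s → ⟦ not s ∧ (p <ᵇ y) ⟧ ℕ.+ ⟦ not s ∧ (y <ᵇ p) ⟧ ≤ 1
  step true = z≤n
  step false with p ℕ.<? y
  ... | yes p<y rewrite <⇒<ᵇ≡true p<y | ≤⇒<ᵇ≡false (ℕ.<⇒≤ p<y) = ℕ.≤-refl
  ... | no p≮y rewrite ≤⇒<ᵇ≡false (ℕ.≮⇒≥ p≮y) with y <ᵇ p
  ...   | true  = ℕ.≤-refl
  ...   | false = z≤n

-- The first letter starts a block and contributes nothing, whence the strict bound. It places every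
-- pair of ascent and descent numbers in the index range of `segmentedSide`.
asc+des< : (r : Vec Letter (suc n)) → IsTrue (headed r) → asc 0 r ℕ.+ des 0 r < suc n
asc+des< ((y , true) ∷ r) _ = s≤s (asc+des≤ y r)

-- Paths

steps : List Step
steps = up ∷ level-θ ∷ level-ξ ∷ down-θξ ∷ []

startsUp? : (π : Vec Step n) → Dec (∀ i → toℕ i ≡ 0 → lookup π i ≡ up)
startsUp? π = Fin.all? (λ i → (toℕ i ℕ.≟ 0) →-dec (lookup π i ≟ˢ up))

startsUp-∷ : ∀ s (π : Vec Step n) → does (startsUp? (s ∷ π)) ≡ does (s ≟ˢ up)
startsUp-∷ s π = does-⇔
  (mk⇔ (λ h → h zero ≡.refl) (λ { s≡up zero _ → s≡up ; _ (suc _) () }))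
  (startsUp? (s ∷ π)) (s ≟ˢ up)

above? : (z : ℤ × ℤ) (π : Vec Step n) → Dec (All (λ z → 1ℤ ℤ.≤ proj₂ z) (verticesFrom z π))
above? z π = All.all? (λ z → 1ℤ ℤ.≤? proj₂ z) (verticesFrom z π)

-- The height before the step is `suc h`: the path is at least at height one there, and a down-step
-- can then land at `h` without subtraction.
height-after : ℕ → Step → ℕ
height-after h up      = 2 ℕ.+ h
height-after h level-θ = suc h
height-after h level-ξ = suc h
height-after h down-θξ = h

y-after : ∀ h s → ℤ.+ suc h ℤ.+ proj₂ (displacement s) ≡ ℤ.+ height-after h s
y-after h up      = cong (ℤ.+_) (ℕ.+-comm (suc h) 1)
y-after h level-θ = cong (ℤ.+_) (ℕ.+-identityʳ (suc h))
y-after h level-ξ = cong (ℤ.+_) (ℕ.+-identityʳ (suc h))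
y-after h down-θξ = ≡.refl

-- Each missing decoration raises `α` by one against the constant -1, so `α` changes as the height
-- does and stays one below it. The subtraction is in the integers because a descent to height zero
-- gives -1.
α-after : ∀ h s → ℤ.+ h ℤ.- 1ℤ ℤ.+ χ (not (θ-decorated s)) ℤ.+ χ (not (ξ-decorated s)) ≡
  ℤ.+ height-after h s ℤ.- 1ℤ
α-after zero    up      = ≡.refl
α-after (suc h) up      = cong (ℤ.+_) (≡.trans (ℕ.+-assoc h 1 1) (ℕ.+-comm h 2))
α-after zero    level-θ = ≡.refl
α-after (suc h) level-θ = cong (ℤ.+_) (≡.trans (ℕ.+-assoc h 0 1) (ℕ.+-comm h 1))
α-after zero    level-ξ = ≡.refl
α-after (suc h) level-ξ = cong (ℤ.+_) (≡.trans (ℕ.+-assoc h 1 0) (ℕ.+-comm h 1))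
α-after zero    down-θξ = ≡.refl
α-after (suc h) down-θξ = cong (ℤ.+_) (≡.trans (ℕ.+-identityʳ _) (ℕ.+-identityʳ _))

-- Weighted sums

module Sums {c ℓ} (R : CommutativeSemiring c ℓ) where

  open CommutativeSemiring R
  open GeneratingFunctions R
  open import Algebra.Definitions.RawSemiring rawSemiring using (_^_; sum; product)
  open import Algebra.Properties.Semiring.Exp semiring using (^-homo-*)
  open import Algebra.Properties.CommutativeSemigroup +-commutativeSemigroup using (interchange)
  open import Algebra.Solver.Ring.NaturalCoefficients.Default R
    using (solve; _:+_; _:*_; _:=_; con)
  open import Relation.Binary.Reasoning.Setoid setoid

  ∑-cong : ∀ (xs : List A) {f g : A → Carrier} → (∀ {x} → x ∈ xs → f x ≈ g x) →
    ∑-list xs f ≈ ∑-list xs g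
  ∑-cong []       h = refl
  ∑-cong (x ∷ xs) h = +-cong (h (here ≡.refl)) (∑-cong xs (h ∘ there))

  ∑-zero : ∀ (xs : List A) → ∑-list xs (λ _ → 0#) ≈ 0#
  ∑-zero []       = refl
  ∑-zero (x ∷ xs) = trans (+-identityˡ _) (∑-zero xs)

  ∑-+ : ∀ (xs : List A) (f g : A → Carrier) →
    ∑-list xs (λ x → f x + g x) ≈ ∑-list xs f + ∑-list xs g
  ∑-+ []       f g = sym (+-identityˡ 0#)
  ∑-+ (x ∷ xs) f g = trans (+-congˡ (∑-+ xs f g)) (interchange _ _ _ _)

  ∑-*ˡ : ∀ (xs : List A) a (f : A → Carrier) → ∑-list xs (λ x → a * f x) ≈ a * ∑-list xs f
  ∑-*ˡ []       a f = sym (zeroʳ a)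
  ∑-*ˡ (x ∷ xs) a f = trans (+-congˡ (∑-*ˡ xs a f)) (sym (distribˡ a _ _))

  ∑-++ : ∀ (xs ys : List A) (f : A → Carrier) →
    ∑-list (xs ++ ys) f ≈ ∑-list xs f + ∑-list ys f
  ∑-++ []       ys f = sym (+-identityˡ _)
  ∑-++ (x ∷ xs) ys f = trans (+-congˡ (∑-++ xs ys f)) (sym (+-assoc _ _ _))

  ∑-map : ∀ (g : A → B) (xs : List A) (f : B → Carrier) →
    ∑-list (List.map g xs) f ≡ ∑-list xs (f ∘ g)
  ∑-map g []       f = ≡.refl
  ∑-map g (x ∷ xs) f = cong (f (g x) +_) (∑-map g xs f)

  ∑-concatMap : ∀ (g : A → List B) (xs : List A) (f : B → Carrier) →
    ∑-list (concatMap g xs) f ≈ ∑-list xs (λ x → ∑-list (g x) f)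
  ∑-concatMap g []       f = refl
  ∑-concatMap g (x ∷ xs) f = trans (∑-++ (g x) _ f) (+-congˡ (∑-concatMap g xs f))

  ∑-cartesianProductWith : ∀ (g : A → B → C) xs ys (f : C → Carrier) →
    ∑-list (cartesianProductWith g xs ys) f ≈ ∑-list xs (λ x → ∑-list ys (λ y → f (g x y)))
  ∑-cartesianProductWith g []       ys f = refl
  ∑-cartesianProductWith g (x ∷ xs) ys f = trans (∑-++ (List.map (g x) ys) _ f)
    (+-cong (reflexive (∑-map (g x) ys f)) (∑-cartesianProductWith g xs ys f))

  ∑-swap : ∀ (xs : List A) (ys : List B) (f : A → B → Carrier) →
    ∑-list xs (λ x → ∑-list ys (f x)) ≈ ∑-list ys (λ y → ∑-list xs (λ x → f x y))
  ∑-swap []       ys f = sym (∑-zero ys)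
  ∑-swap (x ∷ xs) ys f = trans (+-congˡ (∑-swap xs ys f)) (sym (∑-+ ys (f x) _))

  _when_ : Carrier → Bool → Carrier
  a when b = if b then a else 0#

  ∑-filter : ∀ {P : A → Set} (P? : Decidable P) xs (f : A → Carrier) →
    ∑-list (filter P? xs) f ≈ ∑-list xs (λ x → f x when does (P? x))
  ∑-filter P? []       f = refl
  ∑-filter P? (x ∷ xs) f with does (P? x)
  ... | true  = +-congˡ (∑-filter P? xs f)
  ... | false = trans (∑-filter P? xs f) (sym (+-identityˡ _))

  ∑-↭ : ∀ {xs ys} → xs ↭ ys → (f : A → Carrier) → ∑-list xs f ≈ ∑-list ys f
  ∑-↭ ↭.refl          f = refl
  ∑-↭ (↭.prep x p)    f = +-congˡ (∑-↭ p f)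
  ∑-↭ (↭.swap x y p)  f = trans (+-congˡ (+-congˡ (∑-↭ p f)))
    (trans (sym (+-assoc _ _ _)) (trans (+-congʳ (+-comm _ _)) (+-assoc _ _ _)))
  ∑-↭ (↭.trans p p′)  f = trans (∑-↭ p f) (∑-↭ p′ f)

  ∑-single : ∀ {P : A → Set} (P? : Decidable P) {k} → (∀ x → P x ⇔ k ≡ x) →
    {xs : List A} → UniqueList xs → k ∈ xs → ∀ (f : A → Carrier) →
    ∑-list xs (λ x → f x when does (P? x)) ≈ f k
  ∑-single P? {k} P⇔ {x ∷ xs} (x∉ ListAllPairs.∷ u) k∈ f with P? x
  ... | yes p with ≡.refl ← Equivalence.to (P⇔ x) p = begin
    f k + ∑-list xs (λ x → f x when does (P? x)) ≈⟨ +-congˡ (∑-cong xs (λ {y} y∈ →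
      reflexive (cong (f y when_) (dec-false (P? y)
        (ListAll.lookup x∉ y∈ ∘ Equivalence.to (P⇔ y)))))) ⟩
    f k + ∑-list xs (λ _ → 0#)                   ≈⟨ +-congˡ (∑-zero xs) ⟩
    f k + 0#                                     ≈⟨ +-identityʳ _ ⟩
    f k                                          ∎
  ∑-single P? P⇔ (x∉ ListAllPairs.∷ u) (here k≡x) f | no ¬p =
    contradiction (Equivalence.from (P⇔ _) k≡x) ¬p
  ∑-single P? P⇔ (x∉ ListAllPairs.∷ u) (there k∈) f | no ¬p =
    trans (+-identityˡ _) (∑-single P? P⇔ u k∈ f)

  *-when : ∀ a b t → a * (b when t) ≈ (a * b) when t
  *-when a b true  = refl
  *-when a b false = zeroʳ a

  -- After exchanging the sums, each `x` is met at exactly one index, its key. This absorbs the sum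
  -- over `k` and `ℓ`.
  ∑-fibres : ∀ {P : B → A → Set} (P? : ∀ k → Decidable (P k)) (key : A → B) →
    (∀ k x → P k x ⇔ key x ≡ k) → ∀ {ks} → UniqueList ks →
    ∀ xs → (∀ {x} → x ∈ xs → key x ∈ ks) → ∀ (g : B → Carrier) f →
    ∑-list ks (λ k → g k * ∑-list (filter (P? k) xs) f) ≈ ∑-list xs (λ x → g (key x) * f x)
  ∑-fibres P? key P⇔ {ks} u xs key∈ g f = begin
    ∑-list ks (λ k → g k * ∑-list (filter (P? k) xs) f)
      ≈⟨ ∑-cong ks (λ {k} _ → trans (*-congˡ (∑-filter (P? k) xs f))
           (trans (sym (∑-*ˡ xs (g k) _)) (∑-cong xs (λ {x} _ → *-when (g k) (f x) _)))) ⟩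
    ∑-list ks (λ k → ∑-list xs (λ x → (g k * f x) when does (P? k x)))
      ≈⟨ ∑-swap ks xs _ ⟩
    ∑-list xs (λ x → ∑-list ks (λ k → (g k * f x) when does (P? k x)))
      ≈⟨ ∑-cong xs (λ {x} x∈ →
           ∑-single (λ k → P? k x) (λ k → P⇔ k x) u (key∈ x∈) (λ k → g k * f x)) ⟩
    ∑-list xs (λ x → g (key x) * f x) ∎

  module _ (q u v : Carrier) where

    -- q-brackets and weights of arrangements

    bracket : ℕ → Carrier
    bracket m = [ ℤ.+ m ]⟨ q ⟩

    -- `bracket` unfolds at its lowest power, whereas a place further left, with one more block
    -- start behind it, supplies a new highest power.
    bracket-snoc : ∀ m → bracket (suc m) ≈ bracket m + q ^ m
    bracket-snoc zero    = +-comm _ _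
    bracket-snoc (suc m) = begin
      1# + sum {suc m} (λ i → q * q ^ toℕ i)  ≈⟨ +-congˡ (scale (suc m)) ⟩
      1# + q * bracket (suc m)                ≈⟨ +-congˡ (*-congˡ (bracket-snoc m)) ⟩
      1# + q * (bracket m + q ^ m)            ≈⟨ +-congˡ (distribˡ q _ _) ⟩
      1# + (q * bracket m + q * q ^ m)        ≈⟨ +-assoc _ _ _ ⟨
      (1# + q * bracket m) + q * q ^ m        ≈⟨ +-congʳ (+-congˡ (scale m)) ⟨
      bracket (suc m) + q ^ suc m             ∎
      where
      scaleF : ∀ m (f : Fin m → Carrier) → sum {m} (λ i → q * f i) ≈ q * sum {m} f
      scaleF zero    f = sym (zeroʳ q)
      scaleF (suc m) f = trans (+-congˡ (scaleF m (f ∘ suc))) (sym (distribˡ q _ _))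
      scale : ∀ m → sum {m} (λ i → q * q ^ toℕ i) ≈ q * bracket m
      scale m = scaleF m (λ i → q ^ toℕ i)

    weight : ℕ → Vec Letter n → Carrier
    weight p r = u ^ asc p r * v ^ des p r * q ^ smInv r

    weight-∷ : ∀ p y s (r : Vec Letter n) → weight p ((y , s) ∷ r) ≈
      u ^ ⟦ not s ∧ (p <ᵇ y) ⟧ * v ^ ⟦ not s ∧ (y <ᵇ p) ⟧ * q ^ smInvFrom y y r * weight y r
    weight-∷ p y s r = trans
      (*-cong (*-cong (^-homo-* u ⟦ not s ∧ (p <ᵇ y) ⟧ (asc y r))
                      (^-homo-* v ⟦ not s ∧ (y <ᵇ p) ⟧ (des y r)))
              (^-homo-* q (smInvFrom y y r) (smInv r)))
      (solve 6 (λ a b c d e f → (a :* b) :* (c :* d) :* (e :* f) := a :* c :* e :* (b :* d :* f))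
        refl _ _ _ _ _ _)

    -- Since `N` exceeds both neighbours, an unmarked `N` makes an ascent from `p` and an unmarked
    -- `y` a descent from `N`. The last factor is the weight with `y` starting a block and `N`
    -- absent (`weight-start`), and is thus common to all four insertions.
    weight-maximum : ∀ p a y b (r : Vec Letter n) → p < N → y < N → All (_< N) (values r) →
      weight p ((N , a) ∷ (y , b) ∷ r) ≈
      u ^ ⟦ not a ⟧ * v ^ ⟦ not b ⟧ * q ^ (⟦ b ⟧ ℕ.+ blocks r) * (q ^ smInvFrom y y r * weight y r)
    weight-maximum {N = N} p a y b r p<N y<N r<N = begin
      weight p ((N , a) ∷ (y , b) ∷ r)
        ≈⟨ trans (weight-∷ p N a ((y , b) ∷ r)) (*-congˡ (weight-∷ N y b r)) ⟩
      u ^ ⟦ not a ∧ (p <ᵇ N) ⟧ * v ^ ⟦ not a ∧ (N <ᵇ p) ⟧ * q ^ smInvFrom N N ((y , b) ∷ r) *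
        (u ^ ⟦ not b ∧ (N <ᵇ y) ⟧ * v ^ ⟦ not b ∧ (y <ᵇ N) ⟧ * q ^ smInvFrom y y r * weight y r)
        ≡⟨ cong₂ _*_
             (cong₂ _*_ (cong₂ (λ i j → u ^ i * v ^ j)
                                (cong ⟦_⟧ (and-true a (<⇒<ᵇ≡true p<N)))
                                (cong ⟦_⟧ (and-false a (≤⇒<ᵇ≡false (ℕ.<⇒≤ p<N)))))
                        (cong (q ^_) first))
             (cong (λ z → z * q ^ smInvFrom y y r * weight y r)
               (cong₂ (λ i j → u ^ i * v ^ j)
                 (cong ⟦_⟧ (and-false b (≤⇒<ᵇ≡false (ℕ.<⇒≤ y<N))))
                 (cong ⟦_⟧ (and-true b (<⇒<ᵇ≡true y<N))))) ⟩
      u ^ ⟦ not a ⟧ * 1# * q ^ (⟦ b ⟧ ℕ.+ blocks r) *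
        (1# * v ^ ⟦ not b ⟧ * q ^ smInvFrom y y r * weight y r)
        ≈⟨ solve 5 (λ a b c d e → a :* con 1 :* b :* (con 1 :* c :* d :* e)
             := a :* c :* b :* (d :* e)) refl _ _ _ _ _ ⟩
      u ^ ⟦ not a ⟧ * v ^ ⟦ not b ⟧ * q ^ (⟦ b ⟧ ℕ.+ blocks r) *
        (q ^ smInvFrom y y r * weight y r) ∎
      where
      and-true : ∀ a {b} → b ≡ true → (not a ∧ b) ≡ not a
      and-true true  _      = ≡.refl
      and-true false ≡.refl = ≡.refl
      and-false : ∀ a {b} → b ≡ false → (not a ∧ b) ≡ false
      and-false a ≡.refl = ∧-zeroʳ (not a)
      first : smInvFrom N N ((y , b) ∷ r) ≡ ⟦ b ⟧ ℕ.+ blocks r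
      first = smInvFrom-maximum {r = (y , b) ∷ r} ℕ.≤-refl (y<N ∷ r<N)

    weight-start : ∀ p y (r : Vec Letter n) →
      weight p ((y , true) ∷ r) ≈ q ^ smInvFrom y y r * weight y r
    weight-start p y r = trans (weight-∷ p y true r) (trans (*-assoc _ _ _)
      (trans (*-congʳ (*-identityˡ _)) (*-identityˡ _)))

    -- The block that contains p gives one more place to append N than there
    -- are blocks starting in r, whence bracket (suc h) in the third summand.
    -- K is arbitrary because removing a letter that starts a block shifts it.
    ∑-insertions-tail : ∀ {p} (r : Vec Letter n) → p < N → All (_< N) (values r) →
      (K : ℕ → Carrier) → let h = blocks r in
      ∑-list (insertions N r) (λ r′ → weight p r′ * K (blocks r′)) ≈
      weight p r * (bracket (suc h) * K (suc h) + v * bracket h * K h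
                    + u * bracket (suc h) * K h + u * v * bracket h * K (h ∸ 1))
    -- These insertions leave the leading letter in place. Its sminversions do not change
    -- (`smInvFrom-insertions`), so it contributes a constant factor and shifts the argument of `K`
    -- by its own mark.
    ∑-below : ∀ {p} y s (r : Vec Letter n) → y < N → All (_< N) (values r) →
      (K : ℕ → Carrier) → let h = blocks r ; k = λ i → K (⟦ s ⟧ ℕ.+ i) in
      ∑-list (List.map ((y , s) ∷_) (insertions N r)) (λ r′ → weight p r′ * K (blocks r′)) ≈
      weight p ((y , s) ∷ r) * (bracket (suc h) * k (suc h) + v * bracket h * k h
                    + u * bracket (suc h) * k h + u * v * bracket h * k (h ∸ 1))

    ∑-below {N = N} {p} y s r y<N r<N K = begin
      ∑-list (List.map ((y , s) ∷_) (insertions N r)) (λ r′ → weight p r′ * K (blocks r′))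
        ≡⟨ ∑-map ((y , s) ∷_) (insertions N r) _ ⟩
      ∑-list (insertions N r) (λ r′ → weight p ((y , s) ∷ r′) * k (blocks r′))
        ≈⟨ ∑-cong (insertions N r) (λ {r′} r′∈ → trans (*-congʳ (trans (weight-∷ p y s r′)
             (*-congʳ (*-congˡ (reflexive (cong (q ^_) (smInvFrom-insertions y {r} y<N r′∈)))))))
             (*-assoc _ _ _)) ⟩
      ∑-list (insertions N r) (λ r′ → a * (weight y r′ * k (blocks r′)))
        ≈⟨ ∑-*ˡ (insertions N r) a _ ⟩
      a * ∑-list (insertions N r) (λ r′ → weight y r′ * k (blocks r′))
        ≈⟨ *-congˡ (∑-insertions-tail r y<N r<N k) ⟩
      a * (weight y r * _)
        ≈⟨ *-assoc _ _ _ ⟨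
      a * weight y r * _
        ≈⟨ *-congʳ (weight-∷ p y s r) ⟨
      weight p ((y , s) ∷ r) * _ ∎
      where
      k = λ i → K (⟦ s ⟧ ℕ.+ i)
      a = u ^ ⟦ not s ∧ (p <ᵇ y) ⟧ * v ^ ⟦ not s ∧ (y <ᵇ p) ⟧ * q ^ smInvFrom y y r

    -- Truncated subtraction goes wrong only at `h = 0`, where the bracket vanishes.
    bracket-pred : ∀ (K : ℕ → Carrier) h → bracket h * K (suc (h ∸ 1)) ≈ bracket h * K h
    bracket-pred K zero    = trans (zeroˡ _) (sym (zeroˡ _))
    bracket-pred K (suc h) = refl

    ∑-insertions-tail {N = N} {p} [] p<N [] K rewrite <⇒<ᵇ≡true p<N | ≤⇒<ᵇ≡false (ℕ.<⇒≤ p<N) =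
      solve 4 (λ u v k₀ k₁ →
        con 1 :* con 1 :* con 1 :* k₁ :+ (u :* con 1 :* con 1 :* con 1 :* k₀ :+ con 0) :=
        con 1 :* con 1 :* con 1 :* ((con 1 :+ con 0) :* k₁ :+ v :* con 0 :* k₀
          :+ u :* (con 1 :+ con 0) :* k₀ :+ u :* v :* con 0 :* k₀)) refl u v (K 0) (K 1)
    ∑-insertions-tail {p = p} ((y , false) ∷ r) p<N (y<N ∷ r<N) K = ∑-below y false r y<N r<N K
    ∑-insertions-tail {N = N} {p} ((y , true) ∷ r) p<N (y<N ∷ r<N) K = begin
      W true true * K (2 ℕ.+ h) + (W false true * K (1 ℕ.+ h) + (W true false * K (1 ℕ.+ h) +
        (W false false * K h + ∑-list (List.map ((y , true) ∷_) (insertions N r))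
                                      (λ r′ → weight p r′ * K (blocks r′)))))
        ≈⟨ +-cong (w true true) (+-cong (w false true) (+-cong (w true false)
             (+-cong (w false false) (trans (∑-below y true r y<N r<N K) (*-cong head
               (+-cong (+-cong (+-cong (*-congʳ (bracket-snoc h)) refl)
                               (*-congʳ (*-congˡ (bracket-snoc h))))
                 (trans (*-assoc _ _ _) (*-congˡ (bracket-pred K h))))))))) ⟩
      1# * 1# * (q * Q) * X * K (2 ℕ.+ h) + (u * 1# * 1# * (q * Q) * X * K (1 ℕ.+ h)
        + (1# * (v * 1#) * Q * X * K (1 ℕ.+ h) + (u * 1# * (v * 1#) * Q * X * K h
        + X * ((bracket h + Q) * K (2 ℕ.+ h) + v * bracket h * K (1 ℕ.+ h)
        + u * (bracket h + Q) * K (1 ℕ.+ h) + u * v * (bracket h * K h)))))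
        -- As `Q` is `q ^ h`, the sums `b + Q` and `b + Q + q * Q` are the brackets of `h + 1` and
        -- `h + 2`. Each of the four insertions in front of `y` supplies the top power of one
        -- summand; `∑-below` supplies the rest.
        ≈⟨ solve 9 (λ u v q Q X b k₀ k₁ k₂ →
             con 1 :* con 1 :* (q :* Q) :* X :* k₂ :+ (u :* con 1 :* con 1 :* (q :* Q) :* X :* k₁
               :+ (con 1 :* (v :* con 1) :* Q :* X :* k₁
               :+ (u :* con 1 :* (v :* con 1) :* Q :* X :* k₀
               :+ X :* ((b :+ Q) :* k₂ :+ v :* b :* k₁ :+ u :* (b :+ Q) :* k₁
               :+ u :* v :* (b :* k₀))))) :=
             X :* ((b :+ Q :+ q :* Q) :* k₂ :+ v :* (b :+ Q) :* k₁
               :+ u :* (b :+ Q :+ q :* Q) :* k₁ :+ u :* v :* (b :+ Q) :* k₀))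
             refl u v q Q X (bracket h) (K h) (K (suc h)) (K (2 ℕ.+ h)) ⟩
      X * ((bracket h + Q + q * Q) * K (2 ℕ.+ h) + v * (bracket h + Q) * K (1 ℕ.+ h)
        + u * (bracket h + Q + q * Q) * K (1 ℕ.+ h) + u * v * (bracket h + Q) * K h)
        ≈⟨ *-cong head (+-cong (+-cong (+-cong (*-congʳ b₂) (*-congʳ (*-congˡ b₁)))
             (*-congʳ (*-congˡ b₂))) (*-congʳ (*-congˡ b₁))) ⟨
      weight p ((y , true) ∷ r) * _ ∎
      where
      h = blocks r
      Q = q ^ h
      X = q ^ smInvFrom y y r * weight y r
      W : Bool → Bool → Carrier
      W a b = weight p ((N , a) ∷ (y , b) ∷ r)
      w : ∀ a b {k} → W a b * k ≈
        u ^ ⟦ not a ⟧ * v ^ ⟦ not b ⟧ * q ^ (⟦ b ⟧ ℕ.+ h) * X * k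
      w a b = *-congʳ (weight-maximum p a y b r p<N y<N r<N)
      head : weight p ((y , true) ∷ r) ≈ X
      head = weight-start p y r
      b₁ = bracket-snoc h
      b₂ = trans (bracket-snoc (suc h)) (+-congʳ (bracket-snoc h))

    -- Every bracket has the same argument as its `K`, the number of blocks after the insertion. At
    -- `h = 0` only the first summand survives, which matches the compulsory initial up-step.
    transfer : (ℕ → Carrier) → ℕ → Carrier
    transfer K h = bracket (suc h) * K (suc h) + v * bracket h * K h
                   + u * bracket h * K h + u * v * bracket (h ∸ 1) * K (h ∸ 1)

    headedWeight : (ℕ → Carrier) → Vec Letter n → Carrier
    headedWeight K r = (weight 0 r * K (blocks r)) when headed r

    -- In front of the leading letter there is no block to append to or to join with, so compared
    -- with `∑-insertions-tail` the terms in `u` and `u * v` each lose their top power.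
    ∑-insertions : (r : Vec Letter n) → All (_< N) (values r) → (K : ℕ → Carrier) →
      ∑-list (insertions N r) (headedWeight K) ≈ headedWeight (transfer K) r
    ∑-insertions [] [] K =
      solve 4 (λ u v k₀ k₁ →
        con 1 :* con 1 :* con 1 :* k₁ :+ (con 0 :+ con 0) :=
        con 1 :* con 1 :* con 1 :* ((con 1 :+ con 0) :* k₁ :+ v :* con 0 :* k₀
          :+ u :* con 0 :* k₀ :+ u :* v :* con 0 :* k₀)) refl u v (K 0) (K 1)
    ∑-insertions {N = N} ((y , false) ∷ r) (y<N ∷ r<N) K = trans
      (reflexive (∑-map ((y , false) ∷_) (insertions N r) _)) (∑-zero (insertions N r))
    ∑-insertions {N = N} ((y , true) ∷ r) (y<N ∷ r<N) K = begin
      W true * K (2 ℕ.+ h) + (0# + (W false * K (1 ℕ.+ h) + (0#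
        + ∑-list (List.map ((y , true) ∷_) (insertions N r)) (headedWeight K))))
        ≈⟨ +-cong (*-congʳ (w true)) (+-congˡ (+-cong (*-congʳ (w false)) (+-congˡ
             -- Under the map every vector begins with `(y , true)`, where `headedWeight K` computes
             -- to the summand of `∑-below`; hence the passage through `∑-map` and back.
             (trans (reflexive (≡.trans (∑-map ((y , true) ∷_) (insertions N r) _)
                                 (≡.sym (∑-map ((y , true) ∷_) (insertions N r) _))))
               (trans (∑-below {p = 0} y true r y<N r<N K) (*-congˡ (+-cong
                 (+-congˡ (*-congʳ (*-congˡ (bracket-snoc h))))
                 (trans (*-assoc _ _ _) (*-congˡ (bracket-pred K h)))))))))) ⟩
      1# * 1# * (q * Q) * X * K (2 ℕ.+ h) + (0# + (1# * (v * 1#) * Q * X * K (1 ℕ.+ h) + (0#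
        + weight 0 ((y , true) ∷ r) * (bracket (suc h) * K (2 ℕ.+ h) + v * bracket h * K (1 ℕ.+ h)
            + u * (bracket h + Q) * K (1 ℕ.+ h) + u * v * (bracket h * K h)))))
        ≈⟨ +-congˡ (+-congˡ (+-congˡ (+-congˡ (*-cong head
             (+-congʳ (+-congʳ (+-congʳ (*-congʳ (bracket-snoc h))))))))) ⟩
      1# * 1# * (q * Q) * X * K (2 ℕ.+ h) + (0# + (1# * (v * 1#) * Q * X * K (1 ℕ.+ h) + (0#
        + X * ((bracket h + Q) * K (2 ℕ.+ h) + v * bracket h * K (1 ℕ.+ h)
            + u * (bracket h + Q) * K (1 ℕ.+ h) + u * v * (bracket h * K h)))))
        ≈⟨ solve 9 (λ u v q Q X b k₀ k₁ k₂ →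
             con 1 :* con 1 :* (q :* Q) :* X :* k₂ :+ (con 0
               :+ (con 1 :* (v :* con 1) :* Q :* X :* k₁ :+ (con 0
               :+ X :* ((b :+ Q) :* k₂ :+ v :* b :* k₁ :+ u :* (b :+ Q) :* k₁
               :+ u :* v :* (b :* k₀))))) :=
             X :* ((b :+ Q :+ q :* Q) :* k₂ :+ v :* (b :+ Q) :* k₁
               :+ u :* (b :+ Q) :* k₁ :+ u :* v :* b :* k₀))
             refl u v q Q X (bracket h) (K h) (K (suc h)) (K (2 ℕ.+ h)) ⟩
      X * ((bracket h + Q + q * Q) * K (2 ℕ.+ h) + v * (bracket h + Q) * K (1 ℕ.+ h)
        + u * (bracket h + Q) * K (1 ℕ.+ h) + u * v * bracket h * K h)
        ≈⟨ *-cong head (+-congʳ (+-cong (+-cong (*-congʳ b₂) (*-congʳ (*-congˡ b₁)))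
             (*-congʳ (*-congˡ b₁)))) ⟨
      weight 0 ((y , true) ∷ r) * transfer K (suc h) ∎
      where
      h = blocks r
      Q = q ^ h
      X = q ^ smInvFrom y y r * weight y r
      W : Bool → Carrier
      W b = weight 0 ((N , true) ∷ (y , b) ∷ r)
      w : ∀ b → W b ≈ u ^ 0 * v ^ ⟦ not b ⟧ * q ^ (⟦ b ⟧ ℕ.+ h) * X
      w b = weight-maximum 0 true y b r (ℕ.≤-<-trans z≤n y<N) y<N r<N
      head : weight 0 ((y , true) ∷ r) ≈ X
      head = weight-start 0 y r
      b₁ = bracket-snoc h
      b₂ = trans (bracket-snoc (suc h)) (+-congʳ (bracket-snoc h))

    -- The sum over all continuations by m steps of a path at height h.
    pathSum : ℕ → ℕ → Carrier
    pathSum zero    h = 1#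
    pathSum (suc m) h = transfer (pathSum m) h

    -- Letters are summed out from the largest down, and each becomes a step at the front of the
    -- continuation. When none is left, all steps continue the empty path at height zero.
    ∑-arrangements : ∀ n m →
      ∑-list (arrangements n) (headedWeight (pathSum m)) ≈ pathSum (n ℕ.+ m) 0
    ∑-arrangements zero m = trans (+-identityʳ _)
      (trans (*-congʳ (trans (*-identityʳ _) (*-identityʳ _))) (*-identityˡ _))
    ∑-arrangements (suc n) m = begin
      ∑-list (arrangements (suc n)) (headedWeight (pathSum m))
        ≈⟨ ∑-concatMap (insertions n) (arrangements n) _ ⟩
      ∑-list (arrangements n) (λ r → ∑-list (insertions n r) (headedWeight (pathSum m)))
        ≈⟨ ∑-cong (arrangements n) (λ {r} r∈ →
             ∑-insertions r (proj₂ (arrangements-sound r∈)) (pathSum m)) ⟩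
      ∑-list (arrangements n) (headedWeight (pathSum (suc m)))
        ≈⟨ ∑-arrangements n (suc m) ⟩
      pathSum (n ℕ.+ suc m) 0
        ≡⟨ cong (λ k → pathSum k 0) (ℕ.+-suc n m) ⟩
      pathSum (suc n ℕ.+ m) 0 ∎

    segmentedSide≈pathSum : ∀ n → segmentedSide (suc n) q u v ≈ pathSum (suc n) 0
    segmentedSide≈pathSum n = begin
      segmentedSide (suc n) q u v
        ≈⟨ ∑-fibres (λ (k , ℓ) w → (ascents w ℕ.≟ k) ×-dec (descents w ℕ.≟ ℓ))
             key (λ _ _ → mk⇔ (λ (e , e′) → cong₂ _,_ e e′) (λ { ≡.refl → ≡.refl , ≡.refl }))
             (UniqueList.filter⁺ bound? (UniqueList.cartesianProduct⁺
               (UniqueList.upTo⁺ (suc n)) (UniqueList.upTo⁺ (suc n))))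
             (segmentedPermutations (suc n)) key∈ (λ (k , ℓ) → u ^ k * v ^ ℓ) (λ w → q ^ sminv w) ⟩
      ∑-list (segmentedPermutations (suc n)) (λ w → u ^ ascents w * v ^ descents w * q ^ sminv w)
        ≈⟨ ∑-cong (segmentedPermutations (suc n)) (λ {w} w∈ → reflexive
             (cong₂ _*_ (cong₂ (λ i j → u ^ i * v ^ j)
               (ascents-encode w (w-headed w∈)) (descents-encode w (w-headed w∈)))
               (cong (q ^_) (sminv-encode w)))) ⟩
      ∑-list (segmentedPermutations (suc n)) (λ w → weight 0 (encode w))
        ≡⟨ ∑-map encode (segmentedPermutations (suc n)) (weight 0) ⟨
      ∑-list (List.map encode (segmentedPermutations (suc n))) (weight 0)
        ≈⟨ ∑-↭ (segmentedPermutations↭ (suc n)) (weight 0) ⟩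
      ∑-list (filter (T? ∘ headed) (arrangements (suc n))) (weight 0)
        ≈⟨ ∑-filter (T? ∘ headed) (arrangements (suc n)) (weight 0) ⟩
      ∑-list (arrangements (suc n)) (λ r → weight 0 r when headed r)
        ≈⟨ ∑-cong (arrangements (suc n)) (λ {r} _ → unit (weight 0 r) (headed r)) ⟩
      ∑-list (arrangements (suc n)) (headedWeight (pathSum 0))
        ≈⟨ ∑-arrangements (suc n) 0 ⟩
      pathSum (suc n ℕ.+ 0) 0
        ≡⟨ cong (λ k → pathSum k 0) (ℕ.+-identityʳ (suc n)) ⟩
      pathSum (suc n) 0 ∎
      where
      key : SegmentedWord (suc n) → ℕ × ℕ
      key w = ascents w , descents w
      bound? : Decidable (λ (kℓ : ℕ × ℕ) → proj₁ kℓ ℕ.+ proj₂ kℓ < suc n)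
      bound? kℓ = (proj₁ kℓ ℕ.+ proj₂ kℓ) ℕ.<? suc n
      w-headed : ∀ {w} → w ∈ segmentedPermutations (suc n) → IsTrue (headed (encode w))
      w-headed w∈ = proj₂ (encode-sound
        (proj₂ (∈-filter⁻ isSegmentedPermutation? {xs = segmentedWords (suc n)} w∈)))
      key-bound : ∀ {w} → w ∈ segmentedPermutations (suc n) → ascents w ℕ.+ descents w < suc n
      key-bound {w} w∈ = ≡.subst₂ (λ i j → i ℕ.+ j < suc n)
        (≡.sym (ascents-encode w (w-headed w∈))) (≡.sym (descents-encode w (w-headed w∈)))
        (asc+des< (encode w) (w-headed w∈))
      key∈ : ∀ {w} → w ∈ segmentedPermutations (suc n) →
        key w ∈ filter bound? (cartesianProduct (upTo (suc n)) (upTo (suc n)))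
      key∈ {w} w∈ = ∈-filter⁺ bound? (∈-cartesianProduct⁺
        (∈-upTo⁺ (ℕ.≤-<-trans (ℕ.m≤m+n _ _) (key-bound w∈)))
        (∈-upTo⁺ (ℕ.≤-<-trans (ℕ.m≤n+m _ (ascents w)) (key-bound w∈)))) (key-bound w∈)
      unit : ∀ a t → a when t ≈ (a * 1#) when t
      unit a true  = sym (*-identityʳ a)
      unit a false = refl

    -- Sums over paths

    stairFrom : ℤ → Vec Step m → Carrier
    stairFrom {m} a π = product {m} (λ i → [ lookup (αFrom a (T π) (S π)) i ℤ.+ 1ℤ ]⟨ q ⟩)

    pathWeight : ℤ × ℤ → ℤ → Vec Step m → Carrier
    pathWeight z a π = (u ^ degθ π * v ^ degξ π * stairFrom a π) when does (above? z π)

    stepFactor : Step → Carrier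
    stepFactor up      = 1#
    stepFactor level-θ = u
    stepFactor level-ξ = v
    stepFactor down-θξ = u * v

    deg-∷ : ∀ s (π : Vec Step m) →
      u ^ degθ (s ∷ π) * v ^ degξ (s ∷ π) ≈ stepFactor s * (u ^ degθ π * v ^ degξ π)
    deg-∷ up      π = sym (*-identityˡ _)
    deg-∷ level-θ π = *-assoc _ _ _
    deg-∷ level-ξ π = solve 3 (λ a v b → a :* (v :* b) := v :* (a :* b)) refl _ _ _
    deg-∷ down-θξ π = solve 4 (λ u a v b → u :* a :* (v :* b) := u :* v :* (a :* b)) refl _ _ _ _

    ∑-paths : ∀ m x h →
      ∑-list (words steps m) (pathWeight (x , ℤ.+ suc h) (ℤ.+ h)) ≈ pathSum m (suc h)

    ∑-paths-after : ∀ m x h s →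
      ∑-list (words steps m) (λ π → pathWeight (x , ℤ.+ suc h) (ℤ.+ h) (s ∷ π)) ≈
      stepFactor s * (bracket (height-after h s) * pathSum m (height-after h s))
    -- The rewrites express the new height and the new `α` through one natural number. Splitting on
    -- it lets the test against the line y = 1 compute and, in the successor case, turns `α` into
    -- `h′`.
    ∑-paths-after m x h s rewrite y-after h s | α-after h s with height-after h s
    ... | zero   = trans (∑-zero (words steps m)) (sym (trans (*-congˡ (zeroˡ _)) (zeroʳ _)))
    ... | suc h′ = begin
      ∑-list (words steps m) (λ π → (u ^ degθ (s ∷ π) * v ^ degξ (s ∷ π) *
          ([ ℤ.+ (h′ ℕ.+ 1) ]⟨ q ⟩ * stairFrom (ℤ.+ h′) π)) when does (above? z π))
        ≈⟨ ∑-cong (words steps m) (λ {π} _ → regroup π (does (above? z π))) ⟩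
      ∑-list (words steps m) (λ π → stepFactor s * bracket (suc h′) * pathWeight z (ℤ.+ h′) π)
        ≈⟨ ∑-*ˡ (words steps m) _ (pathWeight z (ℤ.+ h′)) ⟩
      stepFactor s * bracket (suc h′) * ∑-list (words steps m) (pathWeight z (ℤ.+ h′))
        ≈⟨ *-congˡ (∑-paths m _ h′) ⟩
      stepFactor s * bracket (suc h′) * pathSum m (suc h′)
        ≈⟨ *-assoc _ _ _ ⟩
      stepFactor s * (bracket (suc h′) * pathSum m (suc h′)) ∎
      where
      z = x ℤ.+ proj₁ (displacement s) , ℤ.+ suc h′
      regroup : ∀ (π : Vec Step m) t → ((u ^ degθ (s ∷ π) * v ^ degξ (s ∷ π) *
          ([ ℤ.+ (h′ ℕ.+ 1) ]⟨ q ⟩ * stairFrom (ℤ.+ h′) π)) when t) ≈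
        stepFactor s * bracket (suc h′) * ((u ^ degθ π * v ^ degξ π * stairFrom (ℤ.+ h′) π) when t)
      regroup π false = sym (zeroʳ _)
      regroup π true = trans
        (*-cong (deg-∷ s π) (*-congʳ (reflexive (cong bracket (ℕ.+-comm h′ 1)))))
        (solve 4 (λ a b c d → a :* b :* (c :* d) := a :* c :* (b :* d)) refl _ _ _ _)

    ∑-paths zero x h = trans (+-identityʳ _) (trans (*-identityʳ _) (*-identityˡ _))
    ∑-paths (suc m) x h = begin
      ∑-list (words steps (suc m)) (pathWeight (x , ℤ.+ suc h) (ℤ.+ h))
        ≈⟨ ∑-cartesianProductWith _∷_ steps (words steps m) _ ⟩
      ∑-list steps (λ s → ∑-list (words steps m) (λ π → pathWeight (x , ℤ.+ suc h) (ℤ.+ h) (s ∷ π)))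
        ≈⟨ ∑-cong steps (λ {s} _ → ∑-paths-after m x h s) ⟩
      ∑-list steps (λ s →
        stepFactor s * (bracket (height-after h s) * pathSum m (height-after h s)))
        ≈⟨ solve 8 (λ u v b₀ b₁ b₂ k₀ k₁ k₂ →
             con 1 :* (b₂ :* k₂) :+ (u :* (b₁ :* k₁) :+ (v :* (b₁ :* k₁)
               :+ (u :* v :* (b₀ :* k₀) :+ con 0))) :=
             b₂ :* k₂ :+ v :* b₁ :* k₁ :+ u :* b₁ :* k₁ :+ u :* v :* b₀ :* k₀)
             refl u v (bracket h) (bracket (suc h)) (bracket (2 ℕ.+ h))
             (pathSum m h) (pathSum m (suc h)) (pathSum m (2 ℕ.+ h)) ⟩
      pathSum (suc m) (suc h) ∎

    pathSide≈pathSum : ∀ n → pathSide (suc n) q u v ≈ pathSum (suc n) 0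
    pathSide≈pathSum n = begin
      pathSide (suc n) q u v
        ≈⟨ ∑-filter isModifiedMotzkin? (words steps (suc n)) weightOf ⟩
      ∑-list (words steps (suc n)) (λ π → weightOf π when does (isModifiedMotzkin? π))
        ≈⟨ ∑-cartesianProductWith _∷_ steps (words steps n) _ ⟩
      ∑-list steps (λ s → ∑-list (words steps n) (λ π →
        weightOf (s ∷ π) when does (isModifiedMotzkin? (s ∷ π))))
        ≈⟨ +-cong first (+-cong (rest level-θ ≡.refl)
             (+-cong (rest level-ξ ≡.refl) (+-congʳ (rest down-θξ ≡.refl)))) ⟩
      bracket 1 * pathSum n 1 + (0# + (0# + (0# + 0#)))
        ≈⟨ solve 5 (λ u v b k₀ k₁ → b :* k₁ :+ (con 0 :+ (con 0 :+ (con 0 :+ con 0))) :=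
             b :* k₁ :+ v :* con 0 :* k₀ :+ u :* con 0 :* k₀ :+ u :* v :* con 0 :* k₀)
             refl u v (bracket 1) (pathSum n 0) (pathSum n 1) ⟩
      pathSum (suc n) 0 ∎
      where
      weightOf : ∀ {n} → Vec Step n → Carrier
      weightOf π = u ^ degθ π * v ^ degξ π * stair q π
      rest : ∀ s → does (s ≟ˢ up) ≡ false → ∑-list (words steps n) (λ π →
        weightOf (s ∷ π) when does (isModifiedMotzkin? (s ∷ π))) ≈ 0#
      rest s s≢up = trans (∑-cong (words steps n) (λ {π} _ → reflexive
        (cong (λ t → weightOf (s ∷ π) when (t ∧ does (above? (0ℤ , 0ℤ) (s ∷ π))))
          (≡.trans (startsUp-∷ s π) s≢up)))) (∑-zero (words steps n))
      regroup : ∀ a b c t → ((a * (b * c)) when t) ≈ b * ((a * c) when t)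
      regroup a b c true  = solve 3 (λ a b c → a :* (b :* c) := b :* (a :* c)) refl a b c
      regroup a b c false = sym (zeroʳ b)
      first : ∑-list (words steps n) (λ π →
        weightOf (up ∷ π) when does (isModifiedMotzkin? (up ∷ π))) ≈ bracket 1 * pathSum n 1
      first = begin
        ∑-list (words steps n) (λ π → weightOf (up ∷ π) when does (isModifiedMotzkin? (up ∷ π)))
          ≈⟨ ∑-cong (words steps n) (λ {π} _ → trans
               (reflexive (cong
                 (λ t → weightOf (up ∷ π) when (t ∧ does (above? (0ℤ , 0ℤ) (up ∷ π))))
                 (startsUp-∷ up π)))
               (regroup _ _ _ (does (above? (1ℤ , 1ℤ) π)))) ⟩
        ∑-list (words steps n) (λ π → bracket 1 * pathWeight (1ℤ , 1ℤ) 0ℤ π)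
          ≈⟨ ∑-*ˡ (words steps n) _ _ ⟩
        bracket 1 * ∑-list (words steps n) (pathWeight (1ℤ , 1ℤ) 0ℤ)
          ≈⟨ *-congˡ (∑-paths n 1ℤ 0) ⟩
        bracket 1 * pathSum n 1 ∎

corollary6p4 : ∀ {c ℓ} (R : CommutativeSemiring c ℓ) →
    let open CommutativeSemiring R
        open GeneratingFunctions R in
    (n : ℕ) .{{_ : NonZero n}} (q u v : Carrier) →
    segmentedSide n q u v ≈ pathSide n q u v
corollary6p4 R (suc n) q u v =
  trans (segmentedSide≈pathSum q u v n) (sym (pathSide≈pathSum q u v n))
  where
  open CommutativeSemiring R
  open Sums R
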